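{- Let $d\geq 0$ be fixed. There is an algorithm which, given a reduced boolean matrix with $n$ columns defining a simplicial complex of dimension $d$, computes the list of faces of this complex in time $O(n^{2d+1})$. Moreover, the facets can be marked in this list in time $O(n^{2d+2})$.
   Context: A (finite) simplicial complex is a pair $(V,H)$ with $V$ finite nonempty and $H\subseteq 2^V$ containing all singletons and closed under subsets; maximal faces are facets; the dimension of a face $I$ is $|I|-1$ and the dimension of the complex is the maximal dimension of a face. A boolean matrix with row set $R$ and column set $V$ is nonsingular if, after independently permuting rows and columns, it is square lower unitriangular; $X\subseteq V$ is $M$-independent if some submatrix $M[Y,X]$ ($Y\subseteq R$) is nonsingular. A boolean matrix $M$ defines (represents) the complex $(V,H)$ where $H$ is the set of $M$-independent subsets of columns. $M$ is reduced if its rows are pairwise distinct and nonzero. Time is measured as the number of elementary operations, with $d$ treated as a constant. -}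

module Defs where

open import Data.Nat using (ℕ; zero; suc; _+_; _*_; _∸_; _^_; _≤_; _≡ᵇ_)
open import Data.Bool using (Bool; true; false; if_then_else_)
open import Data.Fin as Fin using (Fin; toℕ)
open import Data.List using (List; []; _∷_; length; map; concat; tabulate; upTo; [_])
open import Data.List.Relation.Unary.Linked using (Linked)
open import Data.List.Relation.Unary.All using (All)
open import Data.List.Relation.Unary.Unique.Propositional using (Unique)
open import Data.List.Relation.Binary.Permutation.Propositional using (_↭_)
open import Data.List.Relation.Binary.Subset.Propositional using (_⊆_)
open import Data.List.Membership.Propositional using (_∈_)
open import Data.Maybe using (Maybe; just; nothing)
open import Data.Product using (Σ; ∃; ∃-syntax; _×_; _,_)
open import Function.Definitions using (Injective)
open import Relation.Binary.PropositionalEquality using (_≡_)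

Matrix : ℕ → ℕ → Set
Matrix m n = Fin m → Fin n → Bool

-- A finite set of columns is represented canonically by a strictly
-- increasing list of column indices.
StrictSorted : {n : ℕ} → List (Fin n) → Set
StrictSorted = Linked Fin._<_

Reduced : {m n : ℕ} → Matrix m n → Set
Reduced {m} {n} M =
  (∀ (i j : Fin m) → (∀ c → M i c ≡ M j c) → i ≡ j) ×
  (∀ (i : Fin m) → ∃[ c ] (M i c ≡ true))

-- X is M-independent: there are k distinct rows r₀..r_{k-1} and an
-- ordering c₀..c_{k-1} of X such that M[Y,X] with these orderings is
-- lower unitriangular (1 on the diagonal, 0 above it).
Indep : {m n : ℕ} → Matrix m n → List (Fin n) → Set
Indep {m} {n} M X =
  ∃[ k ] Σ (Fin k → Fin m) λ rs → Σ (Fin k → Fin n) λ cs →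
    Injective _≡_ _≡_ rs ×
    (tabulate cs ↭ X) ×
    (∀ i → M (rs i) (cs i) ≡ true) ×
    (∀ i j → i Fin.< j → M (rs i) (cs j) ≡ false)

Face : {m n : ℕ} → Matrix m n → List (Fin n) → Set
Face M X = StrictSorted X × Indep M X

DefinesComplex : {m n : ℕ} → Matrix m n → Set
DefinesComplex {m} {n} M =
  (1 ≤ n) ×
  (∀ (v : Fin n) → Indep M [ v ]) ×
  (∀ X Y → StrictSorted Y → Y ⊆ X → Indep M X → Indep M Y)

HasDim : {m n : ℕ} → Matrix m n → ℕ → Set
HasDim M d =
  (∃[ X ] (Face M X × length X ≡ suc d)) ×
  (∀ X → Face M X → length X ≤ suc d)

Facet : {m n : ℕ} → Matrix m n → List (Fin n) → Set
Facet M F = Face M F × (∀ G → Face M G → F ⊆ G → G ⊆ F)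

-- Machine model: a unit-cost RAM (registers indexed by ℕ, holding ℕ)

data Instr : Set where
  const : ℕ → ℕ → Instr
  add   : ℕ → ℕ → ℕ → Instr
  sub   : ℕ → ℕ → ℕ → Instr
  load  : ℕ → ℕ → Instr
  store : ℕ → ℕ → Instr
  jz    : ℕ → ℕ → Instr
  jmp   : ℕ → Instr
  halt  : Instr

Program : Set
Program = List Instr

Memory : Set
Memory = ℕ → ℕ

record State : Set where
  constructor ⟨_,_⟩
  field
    pc  : ℕ
    mem : Memory
open State public

fetch : Program → ℕ → Maybe Instr
fetch []       _       = nothing
fetch (i ∷ is) zero    = just i
fetch (i ∷ is) (suc k) = fetch is k

write : Memory → ℕ → ℕ → Memory
write R a v x = if x ≡ᵇ a then v else R x

-- One step; nothing means the machine has halted (halt instruction or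
-- program counter outside the program).
step : Program → State → Maybe State
step P ⟨ p , R ⟩ with fetch P p
... | nothing            = nothing
... | just halt          = nothing
... | just (const a k)   = just ⟨ suc p , write R a k ⟩
... | just (add a b c)   = just ⟨ suc p , write R a (R b + R c) ⟩
... | just (sub a b c)   = just ⟨ suc p , write R a (R b ∸ R c) ⟩
... | just (load a b)    = just ⟨ suc p , write R a (R (R b)) ⟩
... | just (store a b)   = just ⟨ suc p , write R (R a) (R b) ⟩
... | just (jz a l)      = just ⟨ (if R a ≡ᵇ 0 then l else suc p) , R ⟩
... | just (jmp l)       = just ⟨ l , R ⟩

-- run P t s = just s' iff P started in s halts after at most t steps
-- (each executed instruction is one elementary operation) in state s'.
run : Program → ℕ → State → Maybe State
run P t s with step P s
... | nothing = just s
run P zero    s | just _  = nothing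
run P (suc t) s | just s' = run P t s'

listMem : List ℕ → Memory
listMem []       _       = 0
listMem (x ∷ xs) zero    = x
listMem (x ∷ xs) (suc k) = listMem xs k

bit : Bool → ℕ
bit true  = 1
bit false = 0

encodeMatrix : {m n : ℕ} → Matrix m n → List ℕ
encodeMatrix {m} {n} M =
  m ∷ n ∷ concat (tabulate λ i → tabulate λ j → bit (M i j))

initState : {m n : ℕ} → Matrix m n → State
initState M = ⟨ 0 , listMem (encodeMatrix M) ⟩

output : Memory → List ℕ
output R = map (λ i → R (suc i)) (upTo (R 0))

encodeFace : {n : ℕ} → List (Fin n) → List ℕ
encodeFace F = length F ∷ map toℕ F

encodeFaces : {n : ℕ} → List (List (Fin n)) → List ℕ
encodeFaces fs = concat (map encodeFace fs)

encodeMarked : {n : ℕ} → List (List (Fin n) × Bool) → List ℕ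
encodeMarked ps = concat (map (λ { (F , b) → bit b ∷ encodeFace F }) ps)

IsFaceList : {m n : ℕ} → Matrix m n → List (List (Fin n)) → Set
IsFaceList {m} {n} M fs =
  All StrictSorted fs × Unique fs ×
  (∀ X → (X ∈ fs → Face M X) × (Face M X → X ∈ fs))

IsMarkedFaceList : {m n : ℕ} → Matrix m n → List (List (Fin n) × Bool) → Set
IsMarkedFaceList M ps =
  IsFaceList M (map Data.Product.proj₁ ps) ×
  All (λ { (F , b) → (b ≡ true → Facet M F) × (Facet M F → b ≡ true) }) ps

-- The RAM runs nested loops over the strictly increasing column lists X of length at most d + 1
-- and tests each for independence, by peeling off a column c with a row that is 1 at c and 0 on
-- the rest of X; peeling is unrolled at compile time, so a test costs O(m) steps for m rows.  A
-- row is determined by at most d columns (a basis of its zero set), so m ≤ (n + 1) ^ d and all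
-- tests together take O(n ^ (2d + 1)) steps.  A face X is a facet iff y ∷ X is dependent for all n
-- columns y, which costs one further factor n.
module Submission where

open import Defs
open import Data.Nat
open import Data.Nat.ListAction using (sum)
open import Data.Nat.Properties
open import Data.Bool using (Bool; true; false; T; if_then_else_)
import Data.Bool.Properties as Bool
open import Data.Fin as Fin using (Fin; toℕ; fromℕ<; combine)
import Data.Fin.Properties as Fin
open import Data.List 
  using (List; []; _∷_; length; map; _++_; concat; concatMap; filter; tabulate; lookup; applyUpTo; reverse; _ʳ++_)
open import Data.List.Membership.Propositional using (_∈_; _∉_; find; lose)
open import Data.List.Membership.Propositional.Properties
  using (∈-map⁺; ∈-map⁻; ∈-∃++; ∈-++⁺ˡ; ∈-++⁺ʳ; ∈-++⁻; ∈-filter⁺; ∈-filter⁻; ∈-lookup)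
open import Data.List.Properties
  using (length-++; length-map; length-tabulate; length-ʳ++; length-reverse; ++-assoc; ++-identityʳ; map-++; map-upTo;
         concatMap-++; tabulate-lookup; reverse-involutive; ∷-injectiveˡ; ∷-injectiveʳ)
open import Data.List.Relation.Binary.Permutation.Propositional
  using (_↭_; refl; prep; swap; ↭-refl; ↭-sym; ↭-trans) renaming (trans to ↭-chain)
open import Data.List.Relation.Binary.Permutation.Propositional.Properties
  using (↭-length; All-resp-↭; ∈-resp-↭; drop-∷; shift)
open import Data.List.Relation.Binary.Pointwise as Pointwise using (Pointwise; []; _∷_)
open import Data.List.Relation.Binary.Subset.Propositional using (_⊆_)
open import Data.List.Relation.Unary.All as All using (All; []; _∷_)
import Data.List.Relation.Unary.All.Properties as All
open import Data.List.Relation.Unary.AllPairs as AllPairs using ([]; _∷_)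
open import Data.List.Relation.Unary.Any as Any using (Any; here; there)
open import Data.List.Relation.Unary.Linked as Linked using (Linked; []; [-]; _∷_)
import Data.List.Relation.Unary.Linked.Properties as Linked
open import Data.List.Relation.Unary.Unique.Propositional using (Unique)
import Data.List.Relation.Unary.Unique.Propositional.Properties as Unique
open import Data.Maybe using (just; nothing)
open import Data.Product using (Σ; ∃; ∃-syntax; _×_; _,_; proj₁; proj₂; map₂)
open import Data.Sum using (_⊎_; inj₁; inj₂)
open import Data.Unit using (⊤; tt)
open import Data.Empty using (⊥-elim)
open import Function using (_∘_; id)
open import Function.Definitions using (Injective)
open import Relation.Binary.Definitions using (tri<; tri≈; tri>)
open import Relation.Binary.PropositionalEquality
  using (_≡_; _≢_; refl; sym; trans; cong; cong₂; subst; subst₂; module ≡-Reasoning)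
open import Relation.Nullary using (¬_; Dec; yes; no; does; ¬?; _×-dec_)
open import Relation.Nullary.Decidable using (decidable-stable; dec-true; dec-false)

-- A structured language on top of the RAM

-- A basis of a zero set has at most d columns, not d + 1, because the row is nonzero: a column
-- where it is 1 can be put in front of the basis and the result is still independent. This saves
-- the factor n that separates 2d + 1 from 2d + 2.
--
-- The main obstacle is storage. What can be spent freely is anything that depends on `d` alone, in
-- code size as well as in time: the 13 + d matrix entries that lie in work registers are carried
-- through by the control flow, the matrix is rebuilt beyond its own extent, and the result is moved
-- down at the very end.
--
-- All time bounds have the form (constant depending on `d`) times (a scale depending on the input).
-- The scale for one column list is `suc m * u`, with u = 1 for listing faces and u = n for marking
-- facets; each of the d + 1 nested loops multiplies it by n.

infixr 4 _⨾_

data Op : Set where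
  const      : ℕ → ℕ → Op
  add sub    : ℕ → ℕ → ℕ → Op
  load store : ℕ → ℕ → Op

data Cmd : Set where
  block : List Op → Cmd
  _⨾_   : Cmd → Cmd → Cmd
  ifz   : ℕ → Cmd → Cmd → Cmd
  while : ℕ → Cmd → Cmd

exec : Op → Memory → Memory
exec (const a k) R = write R a k
exec (add a b c) R = write R a (R b + R c)
exec (sub a b c) R = write R a (R b ∸ R c)
exec (load a b)  R = write R a (R (R b))
exec (store a b) R = write R (R a) (R b)

execs : List Op → Memory → Memory
execs []       R = R
execs (o ∷ os) R = execs os (exec o R)

execs-++ : ∀ os os′ R → execs (os ++ os′) R ≡ execs os′ (execs os R)
execs-++ []       os′ R = refl
execs-++ (o ∷ os) os′ R = execs-++ os os′ (exec o R)

infix 3 _⊢_⇓[_]_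

-- The index in brackets is the exact number of RAM instructions executed by the compiled code. The
-- extra 1 in `ifz-s` is the jump over the zero branch, which the compiler places last; in `while-s`
-- the two extra steps are the test and the jump back.
data _⊢_⇓[_]_ : Memory → Cmd → ℕ → Memory → Set where
  block : ∀ {R os} → R ⊢ block os ⇓[ length os ] execs os R
  seq   : ∀ {R R′ R″ c c′ t t′} → R ⊢ c ⇓[ t ] R′ → R′ ⊢ c′ ⇓[ t′ ] R″ →
          R ⊢ c ⨾ c′ ⇓[ t + t′ ] R″
  ifz-0 : ∀ {R R′ a c c′ t} → R a ≡ 0 → R ⊢ c ⇓[ t ] R′ →
          R ⊢ ifz a c c′ ⇓[ 1 + t ] R′
  ifz-s : ∀ {R R′ a c c′ t} → R a ≢ 0 → R ⊢ c′ ⇓[ t ] R′ →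
          R ⊢ ifz a c c′ ⇓[ 1 + (t + 1) ] R′
  while-0 : ∀ {R a c} → R a ≡ 0 → R ⊢ while a c ⇓[ 1 ] R
  while-s : ∀ {R R′ R″ a c t t′} → R a ≢ 0 → R ⊢ c ⇓[ t ] R′ →
            R′ ⊢ while a c ⇓[ t′ ] R″ → R ⊢ while a c ⇓[ 1 + (t + (1 + t′)) ] R″

instr : Op → Instr
instr (const a k) = const a k
instr (add a b c) = add a b c
instr (sub a b c) = sub a b c
instr (load a b)  = load a b
instr (store a b) = store a b

size : Cmd → ℕ
size (block os)   = length os
size (c ⨾ c′)     = size c + size c′
size (ifz a c c′) = suc (size c′ + suc (size c))
size (while a c)  = suc (size c + 1)

-- The second argument is the address at which the code will be placed; it is needed because jump
-- targets are absolute.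
compile : Cmd → ℕ → Program
compile (block os)   p = map instr os
compile (c ⨾ c′)     p = compile c p ++ compile c′ (p + size c)
compile (ifz a c c′) p =
  jz a (suc p + suc (size c′)) ∷
  compile c′ (suc p) ++ jmp (p + size (ifz a c c′)) ∷ compile c (suc p + suc (size c′))
compile (while a c)  p =
  jz a (p + size (while a c)) ∷ compile c (suc p) ++ jmp p ∷ []

length-compile : ∀ c p → length (compile c p) ≡ size c
length-compile (block os)   p = length-map instr os
length-compile (c ⨾ c′)     p =
  trans (length-++ (compile c p)) (cong₂ _+_ (length-compile c p) (length-compile c′ _))
length-compile (ifz a c c′) p = cong suc (trans (length-++ (compile c′ _))
  (cong₂ _+_ (length-compile c′ _) (cong suc (length-compile c _))))
length-compile (while a c)  p = cong suc (trans (length-++ (compile c _))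
  (cong (_+ 1) (length-compile c _)))

-- Correctness of compilation

data Steps (P : Program) : State → ℕ → State → Set where
  done : ∀ {s} → Steps P s 0 s
  _▸_  : ∀ {s s′ s″ t} → step P s ≡ just s′ → Steps P s′ t s″ → Steps P s (suc t) s″

infixr 5 _▸_ _▸▸_

_▸▸_ : ∀ {P s s′ s″ t t′} → Steps P s t s′ → Steps P s′ t′ s″ → Steps P s (t + t′) s″
done    ▸▸ q = q
(x ▸ p) ▸▸ q = x ▸ (p ▸▸ q)

steps-at : ∀ {P s t p q R} → p ≡ q → Steps P s t ⟨ p , R ⟩ → Steps P s t ⟨ q , R ⟩
steps-at refl ss = ss

record At (P : Program) (p : ℕ) (is : Program) : Set where
  constructor at
  field embed : ∀ k i → fetch is k ≡ just i → fetch P (p + k) ≡ just i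
open At

fetch-++ˡ : ∀ is js k {i} → fetch is k ≡ just i → fetch (is ++ js) k ≡ just i
fetch-++ˡ (_ ∷ is) js zero    eq = eq
fetch-++ˡ (_ ∷ is) js (suc k) eq = fetch-++ˡ is js k eq

fetch-++ʳ : ∀ is js k → fetch (is ++ js) (length is + k) ≡ fetch js k
fetch-++ʳ []       js k = refl
fetch-++ʳ (_ ∷ is) js k = fetch-++ʳ is js k

At-++ˡ : ∀ {P p} is js → At P p (is ++ js) → At P p is
At-++ˡ is js a = at λ k i eq → embed a k i (fetch-++ˡ is js k eq)

At-++ʳ : ∀ {P p} is {js} {l} → length is ≡ l → At P p (is ++ js) → At P (p + l) js
At-++ʳ {P} {p} is refl a = at λ k i eq →
  trans (cong (fetch P) (+-assoc p (length is) k))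
        (embed a (length is + k) i (trans (fetch-++ʳ is _ k) eq))

At-head : ∀ {P p i is} → At P p (i ∷ is) → fetch P p ≡ just i
At-head {P} {p} a = trans (cong (fetch P) (sym (+-identityʳ p))) (embed a 0 _ refl)

At-tail : ∀ {P p i is} → At P p (i ∷ is) → At P (suc p) is
At-tail {P} {p} a = at λ k i eq →
  trans (cong (fetch P) (sym (+-suc p k))) (embed a (suc k) i eq)

step-instr : ∀ {P p R is} o → At P p (instr o ∷ is) → step P ⟨ p , R ⟩ ≡ just ⟨ suc p , exec o R ⟩
step-instr (const a k) a′ rewrite At-head a′ = refl
step-instr (add a b c) a′ rewrite At-head a′ = refl
step-instr (sub a b c) a′ rewrite At-head a′ = refl
step-instr (load a b) a′ rewrite At-head a′ = refl
step-instr (store a b) a′ rewrite At-head a′ = refl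

step-jmp : ∀ {P p R l is} → At P p (jmp l ∷ is) → step P ⟨ p , R ⟩ ≡ just ⟨ l , R ⟩
step-jmp a rewrite At-head a = refl

step-jz-0 : ∀ {P p R a l is} → At P p (jz a l ∷ is) → R a ≡ 0 → step P ⟨ p , R ⟩ ≡ just ⟨ l , R ⟩
step-jz-0 a z rewrite At-head a | z = refl

step-jz-s : ∀ {P p R a l is} → At P p (jz a l ∷ is) → R a ≢ 0 →
            step P ⟨ p , R ⟩ ≡ just ⟨ suc p , R ⟩
step-jz-s {R = R} {a} at-a nz rewrite At-head at-a with R a
... | zero  = ⊥-elim (nz refl)
... | suc _ = refl

steps-block : ∀ {P p R} os → At P p (map instr os) →
              Steps P ⟨ p , R ⟩ (length os) ⟨ p + length os , execs os R ⟩
steps-block {P} {p} {R} [] a rewrite +-identityʳ p = done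
steps-block {P} {p} {R} (o ∷ os) a rewrite +-suc p (length os) =
  step-instr o a ▸ steps-block os (At-tail a)

simulate : ∀ {P R c t R′} → R ⊢ c ⇓[ t ] R′ → ∀ p → At P p (compile c p) →
           Steps P ⟨ p , R ⟩ t ⟨ p + size c , R′ ⟩
simulate (block {os = os}) p a = steps-block os a
simulate {P} (seq {c = c} {c′} d d′) p a =
  steps-at (+-assoc p (size c) (size c′))
    (simulate d p (At-++ˡ (compile c p) _ a) ▸▸
     simulate d′ (p + size c) (At-++ʳ (compile c p) (length-compile c p) a))
simulate {P} (ifz-0 {a = r} {c} {c′} z d) p a =
  steps-at end
    (step-jz-0 a z ▸ simulate d _
      (subst (λ q → At P q (compile c (suc p + suc (size c′)))) (sym (+-suc (suc p) (size c′)))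
        (At-tail (At-++ʳ (compile c′ (suc p)) (length-compile c′ _) (At-tail a)))))
  where
  end : suc p + suc (size c′) + size c ≡ p + size (ifz r c c′)
  end = trans (cong suc (trans (+-assoc p (suc (size c′)) (size c))
                               (cong (p +_) (sym (+-suc (size c′) (size c))))))
              (sym (+-suc p _))
simulate {P} (ifz-s {a = r} {c} {c′} nz d) p a =
  step-jz-s a nz ▸
    (simulate d (suc p) (At-++ˡ (compile c′ (suc p)) _ (At-tail a)) ▸▸
     (step-jmp (At-++ʳ (compile c′ (suc p)) (length-compile c′ _) (At-tail a)) ▸ done))
simulate (while-0 z) p a = step-jz-0 a z ▸ done
simulate {P} (while-s {c = c} nz d d′) p a =
  step-jz-s a nz ▸
    (simulate d (suc p) (At-++ˡ (compile c (suc p)) _ (At-tail a)) ▸▸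
     (step-jmp (At-++ʳ (compile c (suc p)) (length-compile c _) (At-tail a)) ▸
      simulate d′ p a))

fetch-end : ∀ P → fetch P (length P) ≡ nothing
fetch-end []      = refl
fetch-end (_ ∷ P) = fetch-end P

-- Compiled code contains no `halt`: the machine stops because address `length P` lies outside the
-- program.
run-Steps : ∀ {P s t R} → Steps P s t ⟨ length P , R ⟩ → run P t s ≡ just ⟨ length P , R ⟩
run-Steps {P} done rewrite fetch-end P = refl
run-Steps (eq ▸ p) rewrite eq = run-Steps p

run-compile : ∀ {R c t R′} → R ⊢ c ⇓[ t ] R′ →
              run (compile c 0) t ⟨ 0 , R ⟩ ≡ just ⟨ length (compile c 0) , R′ ⟩
run-compile {c = c} d = run-Steps {compile c 0}
  (steps-at (sym (length-compile c 0)) (simulate {compile c 0} d 0 (at λ k i eq → eq)))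

-- Total correctness with an upper bound on time

record WP (R : Memory) (c : Cmd) (t : ℕ) (Q : Memory → Set) : Set where
  constructor wp
  field
    {final} : Memory
    {time}  : ℕ
    evalu   : R ⊢ c ⇓[ time ] final
    time≤   : time ≤ t
    post    : Q final

wp-block : ∀ {R os Q} → Q (execs os R) → WP R (block os) (length os) Q
wp-block q = wp block ≤-refl q

wp-seq : ∀ {R c c′ t t′ Q} → WP R c t (λ R′ → WP R′ c′ t′ Q) → WP R (c ⨾ c′) (t + t′) Q
wp-seq (wp d le (wp d′ le′ q)) = wp (seq d d′) (+-mono-≤ le le′) q

wp-ifz : ∀ {R a c c′ t Q} → (R a ≡ 0 → WP R c t Q) → (R a ≢ 0 → WP R c′ t Q) →
         WP R (ifz a c c′) (2 + t) Q
wp-ifz {R} {a} {t = t} f g with R a ≟ 0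
... | yes z with f z
...   | wp d le q = wp (ifz-0 z d) (s≤s (m≤n⇒m≤1+n le)) q
wp-ifz {R} {a} {t = t} f g | no nz with g nz
...   | wp {time = t′} d le q =
        wp (ifz-s nz d) (s≤s (≤-trans (≤-reflexive (+-comm t′ 1)) (s≤s le))) q

wp-mono : ∀ {R c t t′ Q Q′} → t ≤ t′ → (∀ R′ → Q R′ → Q′ R′) → WP R c t Q → WP R c t′ Q′
wp-mono le f (wp d le′ q) = wp d (≤-trans le′ le) (f _ q)

-- The invariant is indexed by the value of the loop register, which every iteration lowers by one;
-- that value is therefore also the number of iterations left. The 2 pays for the test and the jump
-- back, the final 1 for the test that leaves the loop.
wp-while : ∀ {a c t} (I : ℕ → Memory → Set) →
           (∀ {k R} → I k R → R a ≡ k) →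
           (∀ {k R} → I (suc k) R → WP R c t (I k)) →
           ∀ k {R} → I k R → WP R (while a c) (k * (2 + t) + 1) (I 0)
wp-while I cnt body zero    i = wp (while-0 (cnt i)) ≤-refl i
wp-while {t = t} I cnt body (suc k) i with body i
... | wp {time = t₁} d le i′ with wp-while I cnt body k i′
... | wp {time = t₂} d′ le′ q =
  wp (while-s (λ z → case (trans (sym (cnt i)) z)) d d′)
     (s≤s (≤-trans (≤-reflexive (+-suc t₁ t₂))
       (s≤s (≤-trans (+-mono-≤ le le′) (≤-reflexive (sym (+-assoc t _ 1))))))) q
  where
  case : ∀ {x} → suc k ≡ 0 → x
  case ()

write-≡ : ∀ R a v → write R a v a ≡ v
write-≡ R a v with a ≡ᵇ a in eq
... | true  = refl
... | false = ⊥-elim (subst T eq (≡⇒≡ᵇ a a refl))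

write-≢ : ∀ R {a b} v → b ≢ a → write R a v b ≡ R b
write-≢ R {a} {b} v ne with b ≡ᵇ a in eq
... | true  = ⊥-elim (ne (≡ᵇ⇒≡ b a (subst T (sym eq) _)))
... | false = refl

wp-run : ∀ {R c t Q} → WP R c t Q →
         ∃[ t′ ] ∃[ s ] (t′ ≤ t × run (compile c 0) t′ ⟨ 0 , R ⟩ ≡ just s × Q (State.mem s))
wp-run (wp evalu time≤ post) = _ , _ , time≤ , run-compile evalu , post


-- Independence and facets

splits : ∀ {A : Set} → List A → List (A × List A)
splits []       = []
splits (x ∷ xs) = (x , xs) ∷ map (map₂ (x ∷_)) (splits xs)

∈-splits⁻ : ∀ {A : Set} {c} {cs : List A} xs → (c , cs) ∈ splits xs → c ∷ cs ↭ xs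
∈-splits⁻ (x ∷ xs) (here refl) = ↭-refl
∈-splits⁻ (x ∷ xs) (there p) with ∈-map⁻ _ p
... | (c , cs) , q , refl = ↭-trans (swap c x ↭-refl) (prep x (∈-splits⁻ xs q))

∈-splits⁺ : ∀ {A : Set} {c} {xs : List A} → c ∈ xs → ∃[ cs ] (c , cs) ∈ splits xs
∈-splits⁺ (here refl) = _ , here refl
∈-splits⁺ (there p)   = _ , there (∈-map⁺ _ (proj₂ (∈-splits⁺ p)))

unique-↭ : ∀ {A : Set} {xs ys : List A} → xs ↭ ys → Unique xs → Unique ys
unique-↭ refl u = u
unique-↭ (prep x p) (n ∷ u) = All-resp-↭ p n ∷ unique-↭ p u
unique-↭ (swap x y p) ((x≢y ∷ nx) ∷ ny ∷ u) =
  ((x≢y ∘ sym) ∷ All-resp-↭ p ny) ∷ All-resp-↭ p nx ∷ unique-↭ p u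
unique-↭ (↭-chain p q) u = unique-↭ q (unique-↭ p u)

unique-↭-⊆⊇ : ∀ {A : Set} {xs ys : List A} → Unique xs → Unique ys → xs ⊆ ys → ys ⊆ xs → xs ↭ ys
unique-↭-⊆⊇ {ys = []} [] u f g = ↭-refl
unique-↭-⊆⊇ {ys = y ∷ ys} [] u f g with g (here refl)
... | ()
unique-↭-⊆⊇ {xs = x ∷ xs} {ys} (n ∷ ux) uy f g with ∈-∃++ (f (here refl))
... | as , bs , refl with unique-↭ (shift x as bs) uy
... | n′ ∷ uy′ = ↭-trans (prep x (unique-↭-⊆⊇ ux uy′ f′ g′)) (↭-sym (shift x as bs))
  where
  f′ : xs ⊆ as ++ bs
  f′ p with ∈-resp-↭ (shift x as bs) (f (there p))
  ... | here refl = ⊥-elim (All.lookup n p refl)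
  ... | there q   = q
  g′ : as ++ bs ⊆ xs
  g′ p with g (∈-resp-↭ (↭-sym (shift x as bs)) (there p))
  ... | here refl = ⊥-elim (All.lookup n′ p refl)
  ... | there q   = q

insert : ∀ {n} → Fin n → List (Fin n) → List (Fin n)
insert y []       = y ∷ []
insert y (x ∷ xs) with y Fin.<? x
... | yes _ = y ∷ x ∷ xs
... | no _  = x ∷ insert y xs

insert-↭ : ∀ {n} (y : Fin n) xs → insert y xs ↭ y ∷ xs
insert-↭ y []       = ↭-refl
insert-↭ y (x ∷ xs) with y Fin.<? x
... | yes _ = ↭-refl
... | no _  = ↭-trans (prep x (insert-↭ y xs)) (swap x y ↭-refl)

insert-sorted : ∀ {n} {y : Fin n} {xs} → y ∉ xs → StrictSorted xs → StrictSorted (insert y xs)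
insert-sorted {xs = []} y∉ s = [-]
insert-sorted {y = y} {x ∷ xs} y∉ s with y Fin.<? x
... | yes y<x = y<x ∷ s
... | no y≮x  = link xs s (insert-sorted (y∉ ∘ there) (Linked.tail s))
  where
  x<y : x Fin.< y
  x<y with Fin.<-cmp x y
  ... | tri< l _ _    = l
  ... | tri≈ _ refl _ = ⊥-elim (y∉ (here refl))
  ... | tri> _ _ g    = ⊥-elim (y≮x g)
  link : ∀ xs → StrictSorted (x ∷ xs) → StrictSorted (insert y xs) → StrictSorted (x ∷ insert y xs)
  link []       _       t = x<y ∷ t
  link (z ∷ zs) (l ∷ _) t with y Fin.<? z
  ... | yes _ = x<y ∷ t
  ... | no _  = l ∷ t

sort : ∀ {n} {xs : List (Fin n)} → Unique xs → ∃[ ys ] (StrictSorted ys × ys ↭ xs)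
sort [] = [] , [] , ↭-refl
sort {xs = x ∷ xs} (n ∷ u) with sort u
... | ys , s , p =
  insert x ys , insert-sorted (λ q → All.lookup n (∈-resp-↭ p q) refl) s ,
  ↭-trans (insert-↭ x ys) (prep x p)

sorted-unique : ∀ {n} {xs : List (Fin n)} → StrictSorted xs → Unique xs
sorted-unique s = AllPairs.map (λ l → Fin.<⇒≢ l) (Linked.Linked⇒AllPairs Fin.<-trans s)

true≢false : ∀ {b} → b ≡ true → b ≡ false → ∀ {A : Set} → A
true≢false refl ()

module Independence {m n : ℕ} (M : Matrix m n) where

  Good : Fin n → List (Fin n) → Fin m → Set
  Good c cs r = M r c ≡ true × All (λ x → M r x ≡ false) cs

  good? : ∀ c cs r → Dec (Good c cs r)
  good? c cs r = (M r c Bool.≟ true) ×-dec All.all? (λ x → M r x Bool.≟ false) cs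

  -- The list is itself the column order of a lower unitriangular submatrix: each column has a row
  -- that is 1 there and 0 on all later columns. Distinctness of the rows is not recorded, since
  -- triangularity forces it.
  data Ord : List (Fin n) → Set where
    []  : Ord []
    _∷_ : ∀ {c cs} → ∃ (Good c cs) → Ord cs → Ord (c ∷ cs)

  -- Independence in the form that the program decides: try every column as the first of the order.
  -- The number `k` makes the recursion structural and is meant to equal the length of the list.
  Ind : ℕ → List (Fin n) → Set
  Step : ℕ → Fin n × List (Fin n) → Set
  Ind zero    X = ⊤
  Ind (suc k) X = Any (Step k) (splits X)
  Step k (c , cs) = ∃ (Good c cs) × Ind k cs

  ind? : ∀ k X → Dec (Ind k X)
  step? : ∀ k s → Dec (Step k s)
  ind? zero    X = yes tt
  ind? (suc k) X = Any.any? (step? k) (splits X)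
  step? k (c , cs) = Fin.any? (good? c cs) ×-dec ind? k cs

  Independent : List (Fin n) → Set
  Independent X = ∃[ cs ] (Ord cs × cs ↭ X)

  Ind⇒Independent : ∀ k X → length X ≡ k → Ind k X → Independent X
  Ind⇒Independent zero    []      _  _ = [] , [] , ↭-refl
  Ind⇒Independent (suc k) X eq i with find i
  ... | (c , cs) , c∈ , (r , Mrc , Mrcs) , i′ with ∈-splits⁻ X c∈
  ... | p with Ind⇒Independent k cs (suc-injective (trans (↭-length p) eq)) i′
  ... | os , o , q =
    c ∷ os , (r , Mrc , All-resp-↭ (↭-sym q) Mrcs) ∷ o , ↭-trans (prep c q) p

  -- The first column of a given order is one of the choices offered by `splits`; cancelling it from
  -- both sides of the permutation leaves the tail as an order of the remaining columns.
  Independent⇒Ind : ∀ k X → length X ≡ k → Independent X → Ind k X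
  Independent⇒Ind zero    X eq _ = tt
  Independent⇒Ind (suc k) X eq ([] , o , p) with trans (↭-length p) eq
  ... | ()
  Independent⇒Ind (suc k) X eq (c ∷ os , (r , Mrc , Mros) ∷ o , p)
    with ∈-splits⁺ (∈-resp-↭ p (here refl))
  ... | cs , c∈ = lose c∈
    ((r , Mrc , All-resp-↭ q Mros) ,
     Independent⇒Ind k cs (suc-injective (trans (↭-length (∈-splits⁻ X c∈)) eq)) (os , o , q))
    where
    q : os ↭ cs
    q = drop-∷ (↭-trans p (↭-sym (∈-splits⁻ X c∈)))

  Ord⇒rows : ∀ {cs} → Ord cs → Σ (Fin (length cs) → Fin m) λ rs → ((∀ i → M (rs i) (lookup cs i) ≡ true) ×
             (∀ i j → i Fin.< j → M (rs i) (lookup cs j) ≡ false))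
  Ord⇒rows [] = (λ ()) , (λ ()) , λ ()
  Ord⇒rows {c ∷ cs} ((r , Mrc , Mrcs) ∷ o) with Ord⇒rows o
  ... | rs , diag , upper = rs′ , diag′ , upper′
    where
    rs′ : Fin (suc (length cs)) → Fin m
    rs′ Fin.zero    = r
    rs′ (Fin.suc i) = rs i
    diag′ : ∀ i → M (rs′ i) (lookup (c ∷ cs) i) ≡ true
    diag′ Fin.zero    = Mrc
    diag′ (Fin.suc i) = diag i
    upper′ : ∀ i j → i Fin.< j → M (rs′ i) (lookup (c ∷ cs) j) ≡ false
    upper′ Fin.zero    (Fin.suc j) _       = All.lookup Mrcs (∈-lookup j)
    upper′ (Fin.suc i) (Fin.suc j) (s≤s l) = upper i j l

  Independent⇒Indep : ∀ {X} → Independent X → Indep M X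
  Independent⇒Indep {X} (cs , o , p) with Ord⇒rows o
  ... | rs , diag , upper =
    length cs , rs , lookup cs , inj , subst (_↭ X) (sym (tabulate-lookup cs)) p , diag , upper
    where
    inj : Injective _≡_ _≡_ rs
    -- If rows i < j coincided, that row would be 1 at column j by the diagonal and 0 there by
    -- triangularity.
    inj {i} {j} eq with Fin.<-cmp i j
    ... | tri≈ _ e _ = e
    ... | tri< l _ _ = true≢false (subst (λ r → M r (lookup cs j) ≡ true) (sym eq) (diag j)) (upper i j l)
    ... | tri> _ _ l = true≢false (subst (λ r → M r (lookup cs i) ≡ true) eq (diag i)) (upper j i l)

  rows⇒Ord : ∀ k (rs : Fin k → Fin m) (cs : Fin k → Fin n) → (∀ i → M (rs i) (cs i) ≡ true) →
             (∀ i j → i Fin.< j → M (rs i) (cs j) ≡ false) → Ord (tabulate cs)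
  rows⇒Ord zero    rs cs diag upper = []
  rows⇒Ord (suc k) rs cs diag upper =
    (rs Fin.zero , diag Fin.zero , All.tabulate⁺ (λ j → upper Fin.zero (Fin.suc j) (s≤s z≤n))) ∷
    rows⇒Ord k (rs ∘ Fin.suc) (cs ∘ Fin.suc) (diag ∘ Fin.suc) (λ i j l → upper _ _ (s≤s l))

  Indep⇒Independent : ∀ {X} → Indep M X → Independent X
  Indep⇒Independent (k , rs , cs , _ , p , diag , upper) = tabulate cs , rows⇒Ord k rs cs diag upper , p

  Ord⇒Unique : ∀ {cs} → Ord cs → Unique cs
  Ord⇒Unique [] = []
  Ord⇒Unique {c ∷ cs} ((r , Mrc , Mrcs) ∷ o) =
    All.map (λ { Mrx refl → true≢false Mrc Mrx }) Mrcs ∷ Ord⇒Unique o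

  Independent⇒Unique : ∀ {X} → Independent X → Unique X
  Independent⇒Unique (cs , o , p) = unique-↭ p (Ord⇒Unique o)

  Ord-filter : ∀ {P : Fin n → Set} (P? : ∀ x → Dec (P x)) {cs} → Ord cs → Ord (filter P? cs)
  Ord-filter P? [] = []
  Ord-filter P? {c ∷ cs} ((r , Mrc , Mrcs) ∷ o) with P? c
  ... | yes _ = (r , Mrc , All.filter⁺ P? Mrcs) ∷ Ord-filter P? o
  ... | no _  = Ord-filter P? o

  -- Deleting columns from a triangular order keeps it triangular with the same rows. The filtered
  -- order and `Y` are duplicate-free with the same elements, hence permutations of each other.
  Independent-⊆ : ∀ {X Y} → Unique Y → Y ⊆ X → Independent X → Independent Y
  Independent-⊆ {X} {Y} u Y⊆X (cs , o , p) =
    filter Y? cs , o′ , unique-↭-⊆⊇ (Ord⇒Unique o′) u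
      (λ q → proj₂ (∈-filter⁻ Y? {xs = cs} q))
      (λ q → ∈-filter⁺ Y? (∈-resp-↭ (↭-sym p) (Y⊆X q)) q)
    where
    Y? : ∀ x → Dec (x ∈ Y)
    Y? x = Any.any? (λ y → x Fin.≟ y) Y
    o′ : Ord (filter Y? cs)
    o′ = Ord-filter Y? o

  Maximal : List (Fin n) → Set
  Maximal X = ∀ y → ¬ Ind (suc (length X)) (y ∷ X)

  maximal? : ∀ X → Dec (Maximal X)
  maximal? X = Fin.all? (λ y → ¬? (ind? (suc (length X)) (y ∷ X)))

  -- One-column extensions suffice because independence is hereditary: if a face `G` above `F` had a
  -- column g outside `F`, restricting `G` would make `g ∷ F` independent.
  Maximal⇒Facet : ∀ {F} → Face M F → Maximal F → Facet M F
  Maximal⇒Facet {F} face max = face , λ { G (_ , indep) F⊆G {g} g∈G →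
    decidable-stable (Any.any? (λ y → g Fin.≟ y) F) λ g∉F →
      max g (Independent⇒Ind _ _ refl (Independent-⊆
        (All.tabulate (λ x∈F g≡x → g∉F (subst (_∈ F) (sym g≡x) x∈F)) ∷ sorted-unique (proj₁ face))
        (λ { (here refl) → g∈G ; (there x∈F) → F⊆G x∈F })
        (Indep⇒Independent indep))) }

  -- An independent `y ∷ F` is duplicate-free and sorts to a face `G` above `F`. The facet property
  -- puts y into `F`, against distinctness.
  Facet⇒Maximal : ∀ {F} → Facet M F → Maximal F
  Facet⇒Maximal {F} (face , max) y i = All.lookup (AllPairs.head u) (max G (s , indep) F⊆G y∈G) refl
    where
    ind : Independent (y ∷ F)
    ind = Ind⇒Independent _ _ refl i
    u : Unique (y ∷ F)
    u = Independent⇒Unique ind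
    G : List (Fin n)
    G = proj₁ (sort u)
    s : StrictSorted G
    s = proj₁ (proj₂ (sort u))
    p : G ↭ y ∷ F
    p = proj₂ (proj₂ (sort u))
    indep : Indep M G
    indep = Independent⇒Indep (proj₁ ind , proj₁ (proj₂ ind) , ↭-trans (proj₂ (proj₂ ind)) (↭-sym p))
    F⊆G : F ⊆ G
    F⊆G q = ∈-resp-↭ (↭-sym p) (there q)
    y∈G : y ∈ G
    y∈G = ∈-resp-↭ (↭-sym p) (here refl)

  -- Dependent lists contribute no words, so concatenation over all enumerated lists already gives
  -- the encoding of the face list.
  faceWords : List (Fin n) → List ℕ
  faceWords X = if does (ind? (length X) X) then encodeFace X else []

  markedWords : List (Fin n) → List ℕ
  markedWords X = if does (ind? (length X) X) then bit (does (maximal? X)) ∷ encodeFace X else []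

  Ord-length : ∀ {d} → HasDim M d → ∀ {cs} → Ord cs → length cs ≤ suc d
  Ord-length (_ , bound) {cs} o with sort (Ord⇒Unique o)
  ... | ys , s , p = subst (_≤ _) (↭-length p) (bound ys (s , Independent⇒Indep (cs , o , ↭-sym p)))

  -- A row is determined by a maximal independent subset B of its zero set: the zero
  -- set is the closure of B.  Together with a one of the row, B is independent.
  Vanish : Fin m → List (Fin n) → Set
  Vanish r B = All (λ x → M r x ≡ false) B

  Closing : Fin m → List (Fin n) → Set
  Closing r B = Vanish r B × (∀ z → M r z ≡ false → ∀ r′ → Vanish r′ B → M r′ z ≡ false)

  -- Greedy growth: as long as some zero z of `r` has a row that is 1 at z and 0 on `B`, prepend z.
  -- When there is none, every row vanishing on `B` vanishes on all zeros of `r`. The number `k`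
  -- counts the columns that may still be added.
  closing : ∀ {d} → HasDim M d → (∀ i → ∃[ c ] M i c ≡ true) →
            ∀ k B r → k + length B ≡ d → Ord B → Vanish r B → ∃[ B′ ] (length B′ ≤ d × Closing r B′)
  closing {d} dim ones k B r eq o v
    with Fin.any? (λ z → (M r z Bool.≟ false) ×-dec Fin.any? (good? z B))
  closing {d} dim ones k B r eq o v | no ¬ext =
    B , subst (length B ≤_) eq (m≤n+m (length B) k) , v , λ z Mrz r′ v′ → closed z Mrz r′ v′
    where
    closed : ∀ z → M r z ≡ false → ∀ r′ → Vanish r′ B → M r′ z ≡ false
    closed z Mrz r′ v′ with M r′ z in e
    ... | false = refl
    ... | true  = ⊥-elim (¬ext (z , Mrz , r′ , e , v′))
  closing {d} dim ones (suc k) B r eq o v | yes (z , Mrz , g) =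
    closing dim ones k (z ∷ B) r (trans (+-suc k (length B)) eq) (g ∷ o) (Mrz ∷ v)
  -- Here `B` already has d columns; a column where `r` is 1, followed by z and `B`, would be an
  -- order of d + 2 columns.
  closing {d} dim ones zero B r refl o v | yes (z , Mrz , g) =
    ⊥-elim (1+n≰n (Ord-length dim
      ((r , proj₂ (ones r) , Mrz ∷ v) ∷ g ∷ o)))

  -- Each row vanishes on `B`, hence on every zero of the other row; so the two zero sets agree, and
  -- with them the rows.
  closing-injective : (∀ i j → (∀ c → M i c ≡ M j c) → i ≡ j) →
                      ∀ {r r′ B} → Closing r B → Closing r′ B → r ≡ r′
  closing-injective distinct {r} {r′} (v , cl) (v′ , cl′) = distinct r r′ eq
    where
    eq : ∀ c → M r c ≡ M r′ c
    eq c with M r c in e | M r′ c in e′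
    ... | true  | true  = refl
    ... | false | false = refl
    ... | true  | false = true≢false e (cl′ c e′ r v)
    ... | false | true  = true≢false e′ (cl c e r′ v′)

-- A numeral with d digits in base n + 1: column x is the digit x + 1, and 0 pads beyond the end of
-- the list, so lists of different lengths stay distinguishable.
code : ∀ {n} d → List (Fin n) → Fin (suc n ^ d)
code zero    _        = Fin.zero
code {n} (suc d) [] = combine {suc n} Fin.zero (code d [])
code (suc d) (x ∷ xs) = combine (Fin.suc x) (code d xs)

code-injective : ∀ {n} d {xs ys : List (Fin n)} → length xs ≤ d → length ys ≤ d →
                 code d xs ≡ code d ys → xs ≡ ys
code-injective zero    {[]}     {[]}     _ _ _ = refl
code-injective (suc d) {[]}     {[]}     _ _ _ = refl
code-injective {n} (suc d) {[]}     {y ∷ ys} _ _ eq with Fin.combine-injectiveˡ {m = suc n} Fin.zero (code d []) (Fin.suc y) (code d ys) eq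
... | ()
code-injective {n} (suc d) {x ∷ xs} {[]}     _ _ eq with Fin.combine-injectiveˡ {m = suc n} (Fin.suc x) (code d xs) Fin.zero (code d []) eq
... | ()
code-injective (suc d) {x ∷ xs} {y ∷ ys} (s≤s p) (s≤s q) eq
  with Fin.combine-injective (Fin.suc x) (code d xs) (Fin.suc y) (code d ys) eq
... | e , e′ = cong₂ _∷_ (Fin.suc-injective e) (code-injective d p q e′)

rows≤ : ∀ {m n d} {M : Matrix m n} → Reduced M → HasDim M d → m ≤ suc n ^ d
rows≤ {m} {n} {d} {M} (distinct , ones) dim = Fin.injective⇒≤ {f = f} inj
  where
  open Independence M
  B : ∀ r → ∃[ B ] (length B ≤ d × Closing r B)
  B r = closing dim ones d [] r (+-identityʳ d) [] []
  f : Fin m → Fin (suc n ^ d)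
  f r = code d (proj₁ (B r))
  inj : Injective _≡_ _≡_ f
  inj {r} {r′} eq = closing-injective distinct (proj₂ (proj₂ (B r)))
    (subst (Closing r′) (sym (code-injective d (proj₁ (proj₂ (B r))) (proj₁ (proj₂ (B r′))) eq))
      (proj₂ (proj₂ (B r′))))


-- Testing independence

-- Agreement is stated at `h + a` instead of for all addresses at least h: when h is a numeral,
-- reading past a write to a lower register then reduces by computation.
record SameFrom (h : ℕ) (R R′ : Memory) : Set where
  constructor sameFrom
  field same-at : ∀ a → R′ (h + a) ≡ R (h + a)
open SameFrom

same-refl : ∀ {h R} → SameFrom h R R
same-refl = sameFrom λ _ → refl

same-trans : ∀ {h R R′ R″} → SameFrom h R R′ → SameFrom h R′ R″ → SameFrom h R R″
same-trans s s′ = sameFrom λ a → trans (same-at s′ a) (same-at s a)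

-- Here x is the flag before a test and y the flag after it. A test may set the flag but never
-- clears it, so tests run in sequence compute a disjunction.
Verdict : Set → ℕ → ℕ → Set
Verdict P x y = (P × y ≡ 1) ⊎ (¬ P × y ≡ x)

loop-cost : ∀ k a b → k * a + b ≤ (a + b) * suc k
loop-cost k a b = begin
  k * a + b          ≤⟨ +-mono-≤ (≤-trans (≤-reflexive (*-comm k a)) (*-monoʳ-≤ a (n≤1+n k))) (m≤m*n b (suc k)) ⟩
  a * suc k + b * suc k ≡⟨ sym (*-distribʳ-+ (suc k) a b) ⟩
  (a + b) * suc k    ∎
  where open ≤-Reasoning

-- The rule by which the cost estimates are added up: constants accumulate while the scale s stays
-- fixed.
+-scaled : ∀ {x y} a b s → x ≤ a * s → y ≤ b * s → x + y ≤ (a + b) * s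
+-scaled a b s p q = ≤-trans (+-mono-≤ p q) (≤-reflexive (sym (*-distribʳ-+ s a b)))

-- Splitting is parametric in the entries. Hence the unrolled program, which splits lists of
-- register numbers, runs in step with `Ind`, which splits lists of columns.
splits-Pointwise : ∀ {A B : Set} {_~_ : A → B → Set} {xs ys} → Pointwise _~_ xs ys →
  Pointwise (λ s t → proj₁ s ~ proj₁ t × Pointwise _~_ (proj₂ s) (proj₂ t)) (splits xs) (splits ys)
splits-Pointwise [] = []
splits-Pointwise (p ∷ ps) =
  (p , ps) ∷ Pointwise.map⁺ _ _ (Pointwise.map (map₂ (p ∷_)) (splits-Pointwise ps))

sumRow : List ℕ → List Op
sumRow []       = []
sumRow (l ∷ ls) = add 6 4 (7 + l) ∷ load 6 6 ∷ add 1 1 6 ∷ sumRow ls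

length-sumRow : ∀ ls → length (sumRow ls) ≡ length ls * 3
length-sumRow []       = refl
length-sumRow (_ ∷ ls) = cong (3 +_) (length-sumRow ls)

-- Registers: 0–6 are scratch (2 counts matching rows, 3 is the loop counter, 4 the row address, 5 the
-- verdict of a test), 7 holds the candidate column of the facet test and 8 its outcome, 9 is the
-- output pointer, 10, …, 10 + d hold the columns of the current list, and 11 + d, 12 + d, 13 + d, 14 + d
-- hold n, m, the end of the matrix and the start of the output.  A list ls of columns consists of
-- register numbers minus 7, and addresses are written 7 + a, so that lookups past a write to a
-- scratch register compute.
module Programs (d : ℕ) where

  -- Free of branches: register 1 collects the violations of the row, and 1 minus register 1,
  -- truncated at 0, is added to register 2. Counter and row address are lowered before use, so the
  -- scan starts at the end of the matrix and moves down.
  testRow : ℕ → List ℕ → List Op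
  testRow l ls =
    const 0 1 ∷ sub 3 3 0 ∷ sub 4 4 (11 + d) ∷ add 1 4 (7 + l) ∷ load 1 1 ∷ sub 1 0 1 ∷
    (sumRow ls ++ sub 0 0 1 ∷ add 2 2 0 ∷ [])

  findRow : ℕ → List ℕ → Cmd
  findRow l ls =
    block (const 2 0 ∷ const 0 0 ∷ add 3 (12 + d) 0 ∷ add 4 (13 + d) 0 ∷ []) ⨾
    while 3 (block (testRow l ls))

  -- The 2 is the loop overhead per row; the 5 consists of the four initial instructions and the
  -- last loop test.
  findRow-cost : ℕ → List ℕ → ℕ
  findRow-cost l ls = 2 + length (testRow l ls) + 5

  -- The only loops in the generated code are the scans over the rows; the search through the splits
  -- is unfolded and its size depends on `k` and the length of the list alone. There is no early
  -- exit, since success merely sets register 5.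
  test     : ℕ → List ℕ → Cmd
  testEach : ℕ → List (ℕ × List ℕ) → Cmd
  test zero    ls = block (const 5 1 ∷ [])
  test (suc k) ls = testEach k (splits ls)
  testEach k []              = block []
  testEach k ((l , ls) ∷ ss) = findRow l ls ⨾ ifz 2 (block []) (test k ls) ⨾ testEach k ss

  test-cost     : ℕ → List ℕ → ℕ
  testEach-cost : ℕ → List (ℕ × List ℕ) → ℕ
  test-cost zero    ls = 1
  test-cost (suc k) ls = testEach-cost k (splits ls)
  testEach-cost k []              = 0
  testEach-cost k ((l , ls) ∷ ss) = findRow-cost l ls + ((2 + test-cost k ls) + testEach-cost k ss)

  module Testing {m n : ℕ} (M : Matrix m n) (β : ℕ) where
    open Independence M

    -- The first matrix cell is at address `7 + β`; cells follow row by row.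
    record Env (R : Memory) : Set where
      field
        n-reg   : R (11 + d) ≡ n
        m-reg   : R (12 + d) ≡ m
        end-reg : R (13 + d) ≡ 7 + (β + m * n)
        cell    : ∀ i j → R (7 + (β + toℕ i * n + toℕ j)) ≡ bit (M i j)
    open Env public

    env-same : ∀ {R R′} → SameFrom 7 R R′ → Env R → Env R′
    env-same same env = record
      { n-reg   = trans (same-at same _) (n-reg env)
      ; m-reg   = trans (same-at same _) (m-reg env)
      ; end-reg = trans (same-at same _) (end-reg env)
      ; cell    = λ i j → trans (same-at same _) (cell env i j) }

    Holds : Memory → ℕ → Fin n → Set
    Holds R l x = R (7 + l) ≡ toℕ x

    holds-same : ∀ {R R′ ls X} → SameFrom 7 R R′ → Pointwise (Holds R) ls X → Pointwise (Holds R′) ls X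
    holds-same same = Pointwise.map (trans (same-at same _))

    rowSum : Fin m → List (Fin n) → ℕ
    rowSum r X = sum (map (λ x → bit (M r x)) X)

    record SumRowPost (R R′ : Memory) (s : ℕ) : Set where
      field
        acc  : R′ 1 ≡ R 1 + s
        r0   : R′ 0 ≡ R 0
        r2   : R′ 2 ≡ R 2
        r3   : R′ 3 ≡ R 3
        r4   : R′ 4 ≡ R 4
        r5   : R′ 5 ≡ R 5
        same : SameFrom 7 R R′

    exec-sumRow : ∀ {R ls X ρ} r → R 4 ≡ 7 + ρ → (∀ j → R (7 + (ρ + toℕ j)) ≡ bit (M r j)) →
                  Pointwise (Holds R) ls X → SumRowPost R (execs (sumRow ls) R) (rowSum r X)
    exec-sumRow r e4 cells [] = record
      { acc = sym (+-identityʳ _) ; r0 = refl ; r2 = refl ; r3 = refl ; r4 = refl ; r5 = refl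
      ; same = same-refl }
    exec-sumRow {R} {l ∷ ls} {x ∷ X} {ρ} r e4 cells (p ∷ ps) = record
      { acc = trans (SumRowPost.acc ih)
                (trans (cong (_+ rowSum r X) (cong (R 1 +_) loaded)) (+-assoc (R 1) _ _))
      ; r0 = SumRowPost.r0 ih ; r2 = SumRowPost.r2 ih ; r3 = SumRowPost.r3 ih
      ; r4 = SumRowPost.r4 ih ; r5 = SumRowPost.r5 ih ; same = same-trans (sameFrom λ _ → refl) (SumRowPost.same ih) }
      where
      R₁ : Memory
      R₁ = execs (add 6 4 (7 + l) ∷ load 6 6 ∷ add 1 1 6 ∷ []) R
      loaded : write R 6 (R 4 + R (7 + l)) (R 4 + R (7 + l)) ≡ bit (M r x)
      loaded rewrite e4 | p = cells x
      ih : SumRowPost R₁ (execs (sumRow ls) R₁) (rowSum r X)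
      ih = exec-sumRow r e4 cells ps

    -- Equals 1 for a good row and 0 otherwise: the inner sum counts violations, and truncated
    -- subtraction turns any positive count into 0.
    score : Fin m → Fin n → List (Fin n) → ℕ
    score r c X = 1 ∸ ((1 ∸ bit (M r c)) + rowSum r X)

    rowSum-vanish : ∀ r X → rowSum r X ≡ 0 → Vanish r X
    rowSum-vanish r []      _ = []
    rowSum-vanish r (x ∷ X) e with M r x in eq
    ... | false = eq ∷ rowSum-vanish r X e

    vanish-rowSum : ∀ {r X} → Vanish r X → rowSum r X ≡ 0
    vanish-rowSum []      = refl
    vanish-rowSum (e ∷ v) rewrite e = vanish-rowSum v

    score-good : ∀ {r c X} → Good c X r → score r c X ≡ 1
    score-good (e , v) rewrite e | vanish-rowSum v = refl

    good-score : ∀ r c X → score r c X ≢ 0 → Good c X r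
    good-score r c X ne with M r c
    ... | false = ⊥-elim (ne (0∸n≡0 (rowSum r X)))
    ... | true with rowSum r X in s
    ...   | zero  = refl , rowSum-vanish r X s
    ...   | suc k = ⊥-elim (ne (0∸n≡0 k))

    module _ {R : Memory} {l x ls X} (env : Env R) (h : Holds R l x) (hs : Pointwise (Holds R) ls X) where

      -- Rows k and above have been examined. Register 2 is only compared with 0; it may count
      -- several good rows.
      record Scan (k : ℕ) (R′ : Memory) : Set where
        field
          counter : R′ 3 ≡ k
          row     : R′ 4 ≡ 7 + (β + k * n)
          k≤m     : k ≤ m
          same    : SameFrom 7 R R′
          r5      : R′ 5 ≡ R 5
          found   : (R′ 2 ≡ 0 × (∀ i → k ≤ toℕ i → ¬ Good x X i)) ⊎ (R′ 2 ≢ 0 × ∃ (Good x X))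
      open Scan

      scan-step : ∀ {k R₀} → Scan (suc k) R₀ → Scan k (execs (testRow l ls) R₀)
      scan-step {k} {R₀} s = subst (Scan k) (sym (execs-++ (sumRow ls) _ R₁)) (record
        { counter = trans (SumRowPost.r3 post) (cong (_∸ 1) (counter s))
        ; row     = trans (SumRowPost.r4 post) row₁
        ; k≤m     = <⇒≤ (k≤m s)
        ; same    = same-trans (same-trans (same s) (sameFrom λ _ → refl)) (same-trans (SumRowPost.same post) (sameFrom λ _ → refl))
        ; r5      = trans (SumRowPost.r5 post) (r5 s)
        ; found   = found′ (found s) })
        where
        r : Fin m
        r = fromℕ< (k≤m s)
        r≡k : toℕ r ≡ k
        r≡k = Fin.toℕ-fromℕ< (k≤m s)
        R₁ : Memory
        R₁ = execs (const 0 1 ∷ sub 3 3 0 ∷ sub 4 4 (11 + d) ∷ add 1 4 (7 + l) ∷ load 1 1 ∷ sub 1 0 1 ∷ []) R₀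
        row₁ : R₀ 4 ∸ R₀ (11 + d) ≡ 7 + (β + k * n)
        row₁ = begin
          R₀ 4 ∸ R₀ (11 + d)        ≡⟨ cong₂ _∸_ (row s) (trans (same-at (same s) _) (n-reg env)) ⟩
          7 + (β + suc k * n) ∸ n   ≡⟨ cong (λ q → 7 + q ∸ n) (trans (cong (β +_) (+-comm n (k * n))) (sym (+-assoc β _ n))) ⟩
          7 + (β + k * n) + n ∸ n   ≡⟨ m+n∸n≡m (7 + (β + k * n)) n ⟩
          7 + (β + k * n)           ∎
          where open ≡-Reasoning
        cells : ∀ j → R₀ (7 + (β + k * n + toℕ j)) ≡ bit (M r j)
        cells j = trans (same-at (same s) _) (subst (λ q → R (7 + (β + q * n + toℕ j)) ≡ bit (M r j)) r≡k (cell env r j))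
        acc₁ : R₁ 1 ≡ 1 ∸ bit (M r x)
        acc₁ = cong (1 ∸_) (trans (cong Rₐ (cong₂ _+_ row₁ (trans (same-at (same s) l) h))) (cells x))
          where
          Rₐ : Memory
          Rₐ = execs (const 0 1 ∷ sub 3 3 0 ∷ sub 4 4 (11 + d) ∷ add 1 4 (7 + l) ∷ []) R₀
        post : SumRowPost R₁ (execs (sumRow ls) R₁) (rowSum r X)
        post = exec-sumRow r row₁ cells (holds-same {R′ = R₀} (same s) hs)
        R₂ : Memory
        R₂ = execs (sumRow ls) R₁
        added : R₂ 2 + (R₂ 0 ∸ R₂ 1) ≡ R₀ 2 + score r x X
        added = cong₂ _+_ (SumRowPost.r2 post)
          (cong₂ _∸_ (SumRowPost.r0 post) (trans (SumRowPost.acc post) (cong (_+ rowSum r X) acc₁)))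
        found′ : (R₀ 2 ≡ 0 × (∀ i → suc k ≤ toℕ i → ¬ Good x X i)) ⊎ (R₀ 2 ≢ 0 × ∃ (Good x X)) →
                 (R₂ 2 + (R₂ 0 ∸ R₂ 1) ≡ 0 × (∀ i → k ≤ toℕ i → ¬ Good x X i)) ⊎
                 (R₂ 2 + (R₂ 0 ∸ R₂ 1) ≢ 0 × ∃ (Good x X))
        found′ (inj₂ (ne , g)) = inj₂ ((λ z → ne (m+n≡0⇒m≡0 (R₀ 2) (trans (sym added) z))) , g)
        found′ (inj₁ (z , none)) with score r x X ≟ 0
        ... | yes e = inj₁ (trans added (cong₂ _+_ z e) , none′)
          where
          none′ : ∀ i → k ≤ toℕ i → ¬ Good x X i
          none′ i le g with k ≟ toℕ i
          ... | no ne  = none i (≤∧≢⇒< le ne) g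
          ... | yes eq with Fin.toℕ-injective (trans r≡k eq)
          ...   | refl with trans (sym (score-good g)) e
          ...     | ()
        ... | no ne = inj₂ ((λ z′ → ne (m+n≡0⇒n≡0 (R₀ 2) (trans (sym added) z′))) , r , good-score r x X ne)

      FindRowPost : Memory → Set
      FindRowPost R′ = SameFrom 7 R R′ × R′ 5 ≡ R 5 ×
        ((R′ 2 ≡ 0 × ¬ ∃ (Good x X)) ⊎ (R′ 2 ≢ 0 × ∃ (Good x X)))

      wp-findRow : WP R (findRow l ls) (findRow-cost l ls * suc m) FindRowPost
      wp-findRow = wp-mono cost post
        (wp-seq (wp-block (wp-while Scan counter (λ s → wp-block (scan-step s)) m start)))
        where
        start : Scan m (execs (const 2 0 ∷ const 0 0 ∷ add 3 (12 + d) 0 ∷ add 4 (13 + d) 0 ∷ []) R)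
        start = record
          { counter = trans (+-identityʳ _) (m-reg env)
          ; row     = trans (+-identityʳ _) (end-reg env)
          ; k≤m     = ≤-refl
          ; same    = sameFrom λ _ → refl
          ; r5      = refl
          ; found   = inj₁ (refl , λ i le → ⊥-elim (<⇒≱ (Fin.toℕ<n i) le)) }
        cost : 4 + (m * (2 + length (testRow l ls)) + 1) ≤ findRow-cost l ls * suc m
        cost = ≤-trans (≤-reflexive (trans (+-comm 4 _) (+-assoc (m * (2 + length (testRow l ls))) 1 4)))
                       (loop-cost m _ 5)
        post : ∀ R′ → Scan 0 R′ → FindRowPost R′
        post _ s with found s
        ... | inj₁ (z , none) = same s , r5 s , inj₁ (z , λ { (i , g) → none i z≤n g })
        ... | inj₂ yes′       = same s , r5 s , inj₂ yes′

    TestPost : Memory → Set → Memory → Set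
    TestPost R P R′ = SameFrom 7 R R′ × Verdict P (R 5) (R′ 5)

    HoldsSplit : Memory → ℕ × List ℕ → Fin n × List (Fin n) → Set
    HoldsSplit R s t = Holds R (proj₁ s) (proj₁ t) × Pointwise (Holds R) (proj₂ s) (proj₂ t)

    wp-test : ∀ {R} k {ls X} → Env R → Pointwise (Holds R) ls X →
              WP R (test k ls) (test-cost k ls * suc m) (TestPost R (Ind k X))
    wp-testEach : ∀ {R} k {ss ts} → Env R → Pointwise (HoldsSplit R) ss ts →
                  WP R (testEach k ss) (testEach-cost k ss * suc m) (TestPost R (Any (Step k) ts))
    wp-test zero    env hs = wp-mono (s≤s z≤n) (λ _ → id) (wp-block (sameFrom (λ _ → refl) , inj₁ (tt , refl)))
    wp-test (suc k) env hs = wp-testEach k env (splits-Pointwise hs)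
    wp-testEach k env [] = wp-block (sameFrom (λ _ → refl) , inj₂ ((λ ()) , refl))
    wp-testEach {R} k {(l , ls) ∷ ss} {(x , X) ∷ ts} env ((h , hs) ∷ hss) =
      wp-mono (+-scaled (findRow-cost l ls) _ (suc m) ≤-refl
                (+-scaled (2 + test-cost k ls) _ (suc m)
                  (+-scaled 2 (test-cost k ls) (suc m) (m≤m*n 2 (suc m)) ≤-refl) ≤-refl)) (λ _ → id)
        (wp-seq (wp-mono ≤-refl after (wp-findRow env h hs)))
      where
      after : ∀ R₁ → FindRowPost env h hs R₁ →
              WP R₁ (ifz 2 (block []) (test k ls) ⨾ testEach k ss)
                (2 + test-cost k ls * suc m + testEach-cost k ss * suc m)
                (TestPost R (Any (Step k) ((x , X) ∷ ts)))
      after R₁ (same₁ , r5 , found) = wp-seq (wp-mono ≤-refl last (wp-ifz (skip found) (go found)))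
        where
        skip : (R₁ 2 ≡ 0 × ¬ ∃ (Good x X)) ⊎ (R₁ 2 ≢ 0 × ∃ (Good x X)) → R₁ 2 ≡ 0 →
               WP R₁ (block []) (test-cost k ls * suc m) (TestPost R (Step k (x , X)))
        skip (inj₁ (_ , none)) _ = wp-mono z≤n (λ _ → id) (wp-block (same₁ , inj₂ ((λ st → none (proj₁ st)) , r5)))
        skip (inj₂ (nz , _))   z = ⊥-elim (nz z)
        go : (R₁ 2 ≡ 0 × ¬ ∃ (Good x X)) ⊎ (R₁ 2 ≢ 0 × ∃ (Good x X)) → R₁ 2 ≢ 0 →
             WP R₁ (test k ls) (test-cost k ls * suc m) (TestPost R (Step k (x , X)))
        go (inj₁ (z , _)) nz = ⊥-elim (nz z)
        go (inj₂ (_ , g)) _  = wp-mono ≤-refl combine′ (wp-test k (env-same same₁ env) (holds-same same₁ hs))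
          where
          combine′ : ∀ R₂ → TestPost R₁ (Ind k X) R₂ → TestPost R (Step k (x , X)) R₂
          combine′ _ (same₂ , inj₁ (i , e)) = same-trans same₁ same₂ , inj₁ ((g , i) , e)
          combine′ _ (same₂ , inj₂ (¬i , e)) =
            same-trans same₁ same₂ , inj₂ ((λ st → ¬i (proj₂ st)) , trans e r5)
        last : ∀ R₂ → TestPost R (Step k (x , X)) R₂ →
               WP R₂ (testEach k ss) (testEach-cost k ss * suc m) (TestPost R (Any (Step k) ((x , X) ∷ ts)))
        last R₂ (same₂ , v) = wp-mono ≤-refl combine′
          (wp-testEach k (env-same same₂ env)
            (Pointwise.map (λ { (h′ , hs′) → trans (same-at same₂ _) h′ , holds-same same₂ hs′ }) hss))
          where
          combine′ : ∀ R₃ → TestPost R₂ (Any (Step k) ts) R₃ →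
                     TestPost R (Any (Step k) ((x , X) ∷ ts)) R₃
          combine′ _ (same₃ , w) = same-trans same₂ same₃ , verdict v w
            where
            verdict : ∀ {y z} → Verdict (Step k (x , X)) (R 5) y → Verdict (Any (Step k) ts) y z →
                      Verdict (Any (Step k) ((x , X) ∷ ts)) (R 5) z
            verdict _               (inj₁ (i , e))   = inj₁ (there i , e)
            verdict (inj₁ (i , e))  (inj₂ (_ , e′))  = inj₁ (here i , trans e′ e)
            verdict (inj₂ (¬i , e)) (inj₂ (¬j , e′)) =
              inj₂ ((λ { (here i) → ¬i i ; (there j) → ¬j j }) , trans e′ e)


-- Writing the output and enumerating column lists

data Seg (R : Memory) : ℕ → List ℕ → Set where
  []  : ∀ {p} → Seg R p []
  _∷_ : ∀ {p w ws} → R p ≡ w → Seg R (suc p) ws → Seg R p (w ∷ ws)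

seg-++ : ∀ {R p xs ys} → Seg R p xs → Seg R (p + length xs) ys → Seg R p (xs ++ ys)
seg-++ {R} {p} {ys = ys} [] t = subst (λ q → Seg R q ys) (+-identityʳ p) t
seg-++ {R} {p} {x ∷ xs} {ys} (e ∷ s) t =
  e ∷ seg-++ s (subst (λ q → Seg R q ys) (+-suc p (length xs)) t)

record Keeps (lo hi : ℕ) (R R′ : Memory) : Set where
  constructor keeps
  field kept : ∀ a → lo ≤ a → a < hi → R′ a ≡ R a
open Keeps

keeps-refl : ∀ {lo hi R} → Keeps lo hi R R
keeps-refl = keeps λ _ _ _ → refl

keeps-trans : ∀ {lo hi R R′ R″} → Keeps lo hi R R′ → Keeps lo hi R′ R″ → Keeps lo hi R R″
keeps-trans k k′ = keeps λ a l h → trans (kept k′ a l h) (kept k a l h)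

keeps-mono : ∀ {lo lo′ hi hi′ R R′} → lo ≤ lo′ → hi′ ≤ hi → Keeps lo hi R R′ → Keeps lo′ hi′ R R′
keeps-mono l h k = keeps λ a l′ h′ → kept k a (≤-trans l l′) (≤-trans h′ h)

same⇒keeps : ∀ {lo hi h R R′} → h ≤ lo → SameFrom h R R′ → Keeps lo hi R R′
same⇒keeps {h = h} {R} {R′} h≤ s = keeps λ a l _ →
  subst (λ q → R′ q ≡ R q) (m+[n∸m]≡n (≤-trans h≤ l)) (same-at s (a ∸ h))

seg-keeps : ∀ {lo hi R R′ p ws} → lo ≤ p → p + length ws ≤ hi → Keeps lo hi R R′ → Seg R p ws → Seg R′ p ws
seg-keeps l h k [] = []
seg-keeps {hi = hi} {p = p} {w ∷ ws} l h k (e ∷ s) =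
  trans (kept k p l (≤-trans (m≤m+n (suc p) (length ws)) h′)) e ∷ seg-keeps (m≤n⇒m≤1+n l) h′ k s
  where
  h′ : suc p + length ws ≤ hi
  h′ = ≤-trans (≤-reflexive (sym (+-suc p (length ws)))) h

-- Below `lo` lie the scratch registers and the counters of inner loops, which may change.
-- Everything from `lo` up to the output pointer survives: outer counters, the matrix and the
-- earlier output.
record Emitted (lo : ℕ) (R : Memory) (p : ℕ) (ws : List ℕ) (R′ : Memory) : Set where
  field
    seg : Seg R′ p ws
    ptr : R′ 9 ≡ p + length ws
    below : Keeps lo p R R′
open Emitted

emitted-++ : ∀ {lo R R′ R″ p ws ws′} → lo ≤ p → Emitted lo R p ws R′ →
             Emitted lo R′ (p + length ws) ws′ R″ → Emitted lo R p (ws ++ ws′) R″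
emitted-++ {p = p} {ws} {ws′} lo≤p e e′ = record
  { seg   = seg-++ (seg-keeps lo≤p ≤-refl (below e′) (seg e)) (seg e′)
  ; ptr   = trans (ptr e′) (trans (+-assoc p (length ws) (length ws′)) (cong (p +_) (sym (length-++ ws))))
  ; below = keeps-trans (below e) (keeps-mono ≤-refl (m≤m+n p (length ws)) (below e′)) }

emitted-mono : ∀ {lo lo′ R p ws R′} → lo ≤ lo′ → Emitted lo R p ws R′ → Emitted lo′ R p ws R′
emitted-mono l e = record { seg = seg e ; ptr = ptr e ; below = keeps-mono l ≤-refl (below e) }

emitted-after : ∀ {lo R₀ R p ws R′} → Keeps lo p R₀ R → Emitted lo R p ws R′ → Emitted lo R₀ p ws R′
emitted-after k e = record { seg = seg e ; ptr = ptr e ; below = keeps-trans k (below e) }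

emitted-[] : ∀ {lo R p R′} → R′ 9 ≡ p → Keeps lo p R R′ → Emitted lo R p [] R′
emitted-[] {p = p} e k = record { seg = [] ; ptr = trans e (sym (+-identityʳ p)) ; below = k }

puts : List ℕ → List Op
puts []       = []
puts (r ∷ rs) = store 9 r ∷ add 9 9 0 ∷ puts rs

length-puts : ∀ rs → length (puts rs) ≡ length rs * 2
length-puts []       = refl
length-puts (_ ∷ rs) = cong (2 +_) (length-puts rs)

record Put (R : Memory) (p w : ℕ) (R′ : Memory) : Set where
  field
    ptr   : R′ 9 ≡ suc p
    value : R′ p ≡ w
    other : ∀ a → a ≢ p → a ≢ 9 → R′ a ≡ R a

exec-put : ∀ {R p} r → R 9 ≡ p → R 0 ≡ 1 → 9 < p →
           Put R p (R r) (execs (store 9 r ∷ add 9 9 0 ∷ []) R)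
exec-put {R} {p} r refl one 9<p = record
  { ptr   = trans (cong₂ _+_ (write-≢ R (R r) (<⇒≢ 9<p)) (trans (write-≢ R (R r) (<⇒≢ (≤-trans (s≤s z≤n) 9<p))) one))
                  (+-comm p 1)
  ; value = trans (write-≢ R₁ _ (>⇒≢ 9<p)) (write-≡ R p (R r))
  ; other = λ a a≢p a≢9 → trans (write-≢ R₁ _ a≢9) (write-≢ R (R r) a≢p) }
  where
  R₁ : Memory
  R₁ = write R p (R r)

exec-puts : ∀ {R p} rs → R 9 ≡ p → R 0 ≡ 1 → 9 < p → All (λ r → r < p × r ≢ 9) rs →
            Emitted 10 R p (map R rs) (execs (puts rs) R) 
exec-puts [] e one 9<p [] = emitted-[] e keeps-refl
exec-puts {R} {p} (r ∷ rs) e one 9<p (_ ∷ rs<) = record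
  { seg   = trans (kept (below ih) p 9<p ≤-refl) (Put.value put) ∷
            subst (Seg _ (suc p)) same-values (seg ih)
  ; ptr   = trans (ptr ih) (trans (cong (suc p +_) (trans (cong length same-values) refl)) (sym (+-suc p _)))
  ; below = keeps λ a l h → trans (kept (below ih) a l (m≤n⇒m≤1+n h)) (Put.other put a (<⇒≢ h) (>⇒≢ l)) }
  where
  R₁ : Memory
  R₁ = execs (store 9 r ∷ add 9 9 0 ∷ []) R
  put : Put R p (R r) R₁
  put = exec-put r e one 9<p
  same-values : map R₁ rs ≡ map R rs
  same-values = go rs<
    where
    go : ∀ {rs} → All (λ r → r < p × r ≢ 9) rs → map R₁ rs ≡ map R rs
    go []               = refl
    go ((h , ne) ∷ hs) = cong₂ _∷_ (Put.other put _ (<⇒≢ h) ne) (go hs)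
  ih : Emitted 10 R₁ (suc p) (map R₁ rs) (execs (puts rs) R₁)
  ih = exec-puts rs (Put.ptr put) (trans (Put.other put 0 (<⇒≢ (≤-trans (s≤s z≤n) 9<p)) (λ ())) one)
         (m≤n⇒m≤1+n 9<p) (All.map (λ { (h , ne) → m≤n⇒m≤1+n h , ne }) rs<)

-- Enumerating increasing column lists by nested loops

module Enumeration {n : ℕ} where

  -- Preorder of the loop nest: `X` itself, then its extensions by at most f further columns, all
  -- smaller than b.
  enum : ℕ → ∀ {b} → b ≤ n → List (Fin n) → List (List (Fin n))
  enumBelow : ℕ → ∀ b → b ≤ n → List (Fin n) → List (List (Fin n))
  enum zero    b≤n X = X ∷ []
  enum (suc f) b≤n X = X ∷ enumBelow f _ b≤n X
  enumBelow f zero    b≤n X = []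
  enumBelow f (suc b) b<n X = enum f (<⇒≤ b<n) (fromℕ< b<n ∷ X) ++ enumBelow f b (<⇒≤ b<n) X

  words : (List (Fin n) → List ℕ) → ℕ → ∀ {b} → b ≤ n → List (Fin n) → List ℕ
  words W f b≤n X = concatMap W (enum f b≤n X)

-- The cost of one loop level gains one factor n. The term e pays for the emission, 2 for setting up
-- the counter, 1 for the last test, and 4 per iteration for test, jump and the two decrement
-- instructions; the 7 is 2 + 1 + 4.
visit-arith : ∀ {b n e c N σ} → 1 ≤ n → 1 ≤ N → σ ≤ N → b ≤ n →
              e * σ + (2 + (b * (4 + c * N) + 1)) ≤ (e + (7 + c)) * (n * N)
visit-arith {b} {n} {e} {c} {N} {σ} 1≤n 1≤N σ≤N b≤n =
  +-scaled e (7 + c) (n * N) (*-monoʳ-≤ e (≤-trans σ≤N N≤))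
    (≤-trans (≤-reflexive (cong (2 +_) (+-comm _ 1)))
      (+-scaled 3 (4 + c) (n * N) (≤-trans (m≤m*n 3 N {{>-nonZero 1≤N}}) (*-monoʳ-≤ 3 N≤))
      (begin
        b * (4 + c * N)       ≤⟨ *-mono-≤ b≤n (+-monoˡ-≤ (c * N) (m≤m*n 4 N {{>-nonZero 1≤N}})) ⟩
        n * (4 * N + c * N)   ≡⟨ cong (n *_) (sym (*-distribʳ-+ N 4 c)) ⟩
        n * ((4 + c) * N)     ≡⟨ sym (*-assoc n (4 + c) N) ⟩
        n * (4 + c) * N       ≡⟨ cong (_* N) (*-comm n (4 + c)) ⟩
        (4 + c) * n * N       ≡⟨ *-assoc (4 + c) n N ⟩
        (4 + c) * (n * N)     ∎)))
  where
  open ≤-Reasoning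
  N≤ : N ≤ n * N
  N≤ = m≤n*m N n {{>-nonZero 1≤n}}

module Visits (d : ℕ) (emit : List ℕ → Cmd) (cost : List ℕ → ℕ) where
  open Programs d
  open Enumeration

  -- Each loop counts down from the value of the enclosing loop variable, so the list with the newest
  -- column at its head is increasing.
  visit : ℕ → List ℕ → Cmd
  visit zero    ls = emit ls
  visit (suc f) ls =
    emit ls ⨾ block (const 0 0 ∷ add (10 + f) (11 + f) 0 ∷ []) ⨾
    while (10 + f) (block (const 0 1 ∷ sub (10 + f) (10 + f) 0 ∷ []) ⨾ visit f (3 + f ∷ ls))

  visit-cost : ℕ → List ℕ → ℕ
  visit-cost zero    ls = cost ls
  visit-cost (suc f) ls = cost ls + (7 + visit-cost f (3 + f ∷ ls))

  module Spec {m n : ℕ} (M : Matrix m n) (β : ℕ) (β≥ : 8 + d ≤ β) (1≤n : 1 ≤ n) where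
    open Testing M β

    env-keeps : ∀ {lo p R R′} → lo ≤ 11 + d → 7 + (β + m * n) ≤ p → Keeps lo p R R′ → Env R → Env R′
    env-keeps {lo} {p} lo≤ end≤p k env = record
      { n-reg   = trans (kept k _ lo≤ (low (s≤s (n≤1+n _)))) (n-reg env)
      ; m-reg   = trans (kept k _ (≤-trans lo≤ (n≤1+n _)) (low ≤-refl)) (m-reg env)
      ; end-reg = trans (kept k _ (≤-trans lo≤ (m≤n+m _ 2)) (low′ ≤-refl)) (end-reg env)
      ; cell    = λ i j → trans (kept k _ (addr≥ i j) (≤-trans (+-monoʳ-< 7 (addr< i j)) end≤p)) (cell env i j) }
      where
      low′ : ∀ {a} → a < 14 + d → a < p
      low′ h = ≤-trans h (≤-trans (n≤1+n _) (≤-trans (+-monoʳ-≤ 7 β≥) (≤-trans (+-monoʳ-≤ 7 (m≤m+n β (m * n))) end≤p)))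
      low : ∀ {a} → a < 13 + d → a < p
      low h = low′ (m≤n⇒m≤1+n h)
      addr≥ : ∀ i j → lo ≤ 7 + (β + toℕ {m} i * n + toℕ {n} j)
      addr≥ i j = ≤-trans lo≤ (≤-trans (m≤n+m _ 4) (+-monoʳ-≤ 7 (≤-trans β≥ (≤-trans (m≤m+n β _) (m≤m+n _ (toℕ j))))))
      addr< : ∀ i j → β + toℕ {m} i * n + toℕ {n} j < β + m * n
      addr< i j = begin-strict
        β + toℕ i * n + toℕ j   <⟨ +-monoʳ-< (β + toℕ i * n) (Fin.toℕ<n j) ⟩
        β + toℕ i * n + n       ≡⟨ +-assoc β _ n ⟩
        β + (toℕ i * n + n)     ≡⟨ cong (β +_) (+-comm _ n) ⟩
        β + suc (toℕ i) * n     ≤⟨ +-monoʳ-≤ β (*-monoˡ-≤ n (Fin.toℕ<n i)) ⟩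
        β + m * n               ∎
        where open ≤-Reasoning

    -- With the offset 7 the bounds say that the column sits in a register from 10 + lo to 10 + d,
    -- out of reach of the loop counters below 10 + lo.
    Slot : ℕ → Memory → ℕ → Fin n → Set
    Slot lo R l x = (3 + lo ≤ l × l ≤ 3 + d) × Holds R l x

    -- The factor `cost ls` is fixed at compile time; `σ` carries all dependence on the size of the
    -- matrix.
    EmitSpec : ℕ → (List (Fin n) → List ℕ) → Set
    EmitSpec σ W = ∀ {R p ls X} → Env R → 7 + (β + m * n) ≤ p → R 9 ≡ p → Pointwise (Slot 0 R) ls X →
      WP R (emit ls) (cost ls * σ) (Emitted 10 R p (W X))

    module _ (σ : ℕ) (1≤σ : 1 ≤ σ) (W : List (Fin n) → List ℕ) (wp-emit : EmitSpec σ W) where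

      low<p : ∀ {a p} → 7 + (β + m * n) ≤ p → a < 15 + d → a < p
      low<p end≤p h = ≤-trans h (≤-trans (+-monoʳ-≤ 7 (≤-trans β≥ (m≤m+n β (m * n)))) end≤p)

      N≥1 : ∀ f → 1 ≤ n ^ f * σ
      N≥1 f = *-mono-≤ (m^n>0 n {{>-nonZero 1≤n}} f) 1≤σ

      -- Register 10 + f is the counter of the enclosing loop and bounds the new columns. At the
      -- outermost level, f = d + 1, it is register 11 + d, which holds n, so the first loop needs
      -- no special case.
      wp-visit : ∀ f → f ≤ suc d → ∀ {b} (b≤n : b ≤ n) {R p ls X} → Env R → 7 + (β + m * n) ≤ p → R 9 ≡ p →
                 R (10 + f) ≡ b → Pointwise (Slot f R) ls X →
                 WP R (visit f ls) (visit-cost f ls * (n ^ f * σ)) (Emitted (10 + f) R p (words W f b≤n X))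
      wp-visit zero f≤ b≤n {ls = ls} {X} env end≤p e9 eb slots =
        wp-mono (*-monoʳ-≤ (cost ls) (≤-reflexive (sym (+-identityʳ σ))))
          (λ R′ → subst (λ ws → Emitted 10 _ _ ws R′) (sym (++-identityʳ (W X))))
          (wp-emit env end≤p e9 slots)
      wp-visit (suc f) f< {b} b≤n {R₀} {p} {ls} {X} env end≤p e9 eb slots =
        wp-mono cost≤ finish
          (wp-seq (wp-mono ≤-refl (λ _ e → wp-seq (wp-block (wp-while Inv counter body b (start e))))
            (wp-emit env end≤p e9 (Pointwise.map (λ { ((l , u) , h) → (≤-trans (m≤m+n 3 (suc f)) l , u) , h }) slots))))
        where
        inner-cost : ℕ
        inner-cost = visit-cost f (3 + f ∷ ls) * (n ^ f * σ)
        cost≤ : cost ls * σ + (2 + (b * (2 + (2 + inner-cost)) + 1)) ≤ visit-cost (suc f) ls * (n ^ suc f * σ)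
        cost≤ = ≤-trans
          (visit-arith {e = cost ls} {visit-cost f (3 + f ∷ ls)} 1≤n (N≥1 f)
            (m≤n*m σ (n ^ f) {{>-nonZero (m^n>0 n {{>-nonZero 1≤n}} f)}}) b≤n)
          (≤-reflexive (cong (visit-cost (suc f) ls *_) (sym (*-assoc n (n ^ f) σ))))
        11+f≤ : 11 + f ≤ 11 + d
        11+f≤ = +-monoʳ-≤ 10 f<
        11+f≤p : 11 + f ≤ p
        11+f≤p = <⇒≤ (low<p end≤p (≤-trans (s≤s 11+f≤) (m≤n+m _ 3)))
        rest : ∀ k → k ≤ n → List ℕ
        rest k k≤n = concatMap W (enumBelow f k k≤n X)
        record Inv (k : ℕ) (R : Memory) : Set where
          field
            k≤n     : k ≤ n
            counter : R (10 + f) ≡ k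
            so-far  : List ℕ
            emitted : Emitted (11 + f) R₀ p so-far R
            total   : so-far ++ rest k k≤n ≡ words W (suc f) b≤n X
        open Inv
        start : ∀ {R} → Emitted 10 R₀ p (W X) R → Inv b (execs (const 0 0 ∷ add (10 + f) (11 + f) 0 ∷ []) R)
        start {R} e = record
          { k≤n     = b≤n
          ; counter = trans (write-≡ R₁ (10 + f) _) (trans (+-identityʳ _)
                        (trans (kept (below e) (11 + f) (m≤m+n 10 (suc f)) (low<p end≤p (s≤s (≤-trans 11+f≤ (m≤n+m _ 3))))) eb))
          ; so-far  = W X
          ; emitted = record
              { seg   = seg-keeps 11+f≤p ≤-refl k₁ (seg e)
              ; ptr   = ptr e
              ; below = keeps-trans (keeps-mono (m≤m+n 10 (suc f)) ≤-refl (below e)) k₁ }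
          ; total   = refl }
          where
          R₁ : Memory
          R₁ = write R 0 0
          k₁ : ∀ {hi} → Keeps (11 + f) hi R (execs (const 0 0 ∷ add (10 + f) (11 + f) 0 ∷ []) R)
          k₁ = keeps λ { (suc a) l _ → write-≢ R₁ _ (>⇒≢ l) }
        body : ∀ {k R} → Inv (suc k) R →
               WP R (block (const 0 1 ∷ sub (10 + f) (10 + f) 0 ∷ []) ⨾ visit f (3 + f ∷ ls)) (2 + inner-cost) (Inv k)
        body {k} {R} j = wp-seq (wp-block (wp-mono ≤-refl next
          (wp-visit f (<⇒≤ f<) (<⇒≤ (k≤n j)) (env-keeps 11+f≤ end≤p from₀ env)
            (≤-trans end≤p (m≤m+n p _)) (ptr (emitted j)) counter₁ slots₁)))
          where
          R₁ : Memory
          R₁ = execs (const 0 1 ∷ sub (10 + f) (10 + f) 0 ∷ []) R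
          counter₁ : R₁ (10 + f) ≡ k
          counter₁ = trans (write-≡ (write R 0 1) (10 + f) _) (cong (_∸ 1) (counter j))
          k₁ : ∀ {hi} → Keeps (11 + f) hi R R₁
          k₁ = keeps λ { (suc a) l _ → write-≢ (write R 0 1) _ (>⇒≢ l) }
          from₀ : Keeps (11 + f) p R₀ R₁
          from₀ = keeps-trans (below (emitted j)) k₁
          slots₁ : Pointwise (Slot f R₁) (3 + f ∷ ls) (fromℕ< (k≤n j) ∷ X)
          slots₁ = ((≤-refl , +-monoʳ-≤ 3 (s≤s⁻¹ f<)) , trans counter₁ (sym (Fin.toℕ-fromℕ< (k≤n j)))) ∷
            Pointwise.map (λ { ((l , u) , h) → (≤-trans (n≤1+n _) l , u) ,
              trans (kept from₀ _ (+-monoʳ-≤ 7 l) (low<p end≤p (≤-trans (+-monoʳ-≤ 8 u) (m≤n+m _ 4)))) h }) slots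
          next : ∀ R₂ → Emitted (10 + f) R₁ (p + length (so-far j)) (words W f (<⇒≤ (k≤n j)) (fromℕ< (k≤n j) ∷ X)) R₂ →
                 Inv k R₂
          next R₂ e = record
            { k≤n     = <⇒≤ (k≤n j)
            ; counter = trans (kept (below e) (10 + f) ≤-refl (≤-trans 11+f≤p (m≤m+n p _))) counter₁
            ; so-far  = so-far j ++ words W f (<⇒≤ (k≤n j)) (fromℕ< (k≤n j) ∷ X)
            ; emitted = emitted-++ 11+f≤p (emitted j) (emitted-after k₁ (emitted-mono (n≤1+n _) e))
            ; total   = trans (++-assoc (so-far j) _ _)
                (trans (cong (so-far j ++_) (sym (concatMap-++ W (enum f (<⇒≤ (k≤n j)) (fromℕ< (k≤n j) ∷ X)) _))) (total j)) }
        finish : ∀ R → Inv 0 R → Emitted (11 + f) R₀ p (words W (suc f) b≤n X) R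
        finish R j = subst (λ ws → Emitted (11 + f) R₀ p ws R) (trans (sym (++-identityʳ (so-far j))) (total j)) (emitted j)

      -- The output length satisfies the recurrence of the running time, so the same estimate bounds
      -- it. It is needed because the final move pays for every word.
      words-length : (∀ ls X → length ls ≡ length X → length (W X) ≤ cost ls * σ) →
                     ∀ f {b} (b≤n : b ≤ n) ls X → length ls ≡ length X →
                     length (words W f b≤n X) ≤ visit-cost f ls * (n ^ f * σ)
      words-length W≤ zero b≤n ls X eq = subst₂ _≤_ (cong length (sym (++-identityʳ (W X))))
        (cong (cost ls *_) (sym (+-identityʳ σ))) (W≤ ls X eq)
      words-length W≤ (suc f) {b} b≤n ls X eq = ≤-trans
        (≤-trans (≤-reflexive (length-++ (W X)))
          (+-mono-≤ (W≤ ls X eq) (≤-trans (below≤ b b≤n) (≤-trans (*-monoʳ-≤ b (m≤n+m inner-cost 4)) (≤-trans (m≤m+n _ 1) (m≤n+m _ 2))))))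
        (≤-trans (visit-arith {e = cost ls} {visit-cost f (3 + f ∷ ls)} 1≤n (N≥1 f)
            (m≤n*m σ (n ^ f) {{>-nonZero (m^n>0 n {{>-nonZero 1≤n}} f)}}) b≤n)
          (≤-reflexive (cong (visit-cost (suc f) ls *_) (sym (*-assoc n (n ^ f) σ)))))
        where
        inner-cost : ℕ
        inner-cost = visit-cost f (3 + f ∷ ls) * (n ^ f * σ)
        below≤ : ∀ k (k≤n : k ≤ n) → length (concatMap W (enumBelow f k k≤n X)) ≤ k * inner-cost
        below≤ zero    k≤n = z≤n
        below≤ (suc k) k<n = ≤-trans (≤-reflexive (trans
          (cong length (concatMap-++ W (enum f (<⇒≤ k<n) (fromℕ< k<n ∷ X)) _))
          (length-++ (concatMap W (enum f (<⇒≤ k<n) (fromℕ< k<n ∷ X))))))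
          (+-mono-≤ (words-length W≤ f (<⇒≤ k<n) (3 + f ∷ ls) (fromℕ< k<n ∷ X) (cong suc eq)) (below≤ k (<⇒≤ k<n)))


-- Emitting faces and marked faces

≤-scaled : ∀ c {s} → 1 ≤ s → c ≤ c * s
≤-scaled c {s} 1≤s = m≤m*n c s {{>-nonZero 1≤s}}

module Emitters (d : ℕ) where
  open Programs d

  guard : ℕ → List ℕ → Cmd → Cmd
  guard k ls c = block (const 5 0 ∷ []) ⨾ test k ls ⨾ ifz 5 (block []) c

  -- The list `ps` names extra registers to be written first, such as register 8 with the mark.
  -- Entries of `ps` and `ls` are shifted by 7, whereas the bare `1` between them is register 1
  -- itself, holding the length known at compile time.
  output-ops : List ℕ → List ℕ → List Op
  output-ops ps ls = const 0 1 ∷ const 1 (length ls) ∷ puts (map (7 +_) ps ++ 1 ∷ map (7 +_) ls)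

  emitFace : List ℕ → Cmd
  emitFace ls = guard (length ls) ls (block (output-ops [] ls))

  emitFace-cost : List ℕ → ℕ
  emitFace-cost ls = 1 + (test-cost (length ls) ls + (2 + length (output-ops [] ls)))

  -- Columns y of the list itself need not be excluded: a list with a repetition is never independent.
  emitMarked : List ℕ → Cmd
  emitMarked ls = guard (length ls) ls
    (block (const 8 1 ∷ const 0 0 ∷ add 7 (11 + d) 0 ∷ []) ⨾
     while 7 (block (const 0 1 ∷ sub 7 7 0 ∷ []) ⨾ guard (suc (length ls)) (0 ∷ ls) (block (const 8 0 ∷ []))) ⨾
     block (output-ops (1 ∷ []) ls))

  emitMarked-cost : List ℕ → ℕ
  emitMarked-cost ls = 1 + (test-cost (length ls) ls + (2 + (3 +
    ((8 + test-cost (suc (length ls)) (0 ∷ ls) + 1) + length (output-ops (1 ∷ []) ls)))))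

  module Spec {m n : ℕ} (M : Matrix m n) (β : ℕ) (β≥ : 8 + d ≤ β) (1≤n : 1 ≤ n) where
    open Testing M β
    open Independence M
    module VisitFace = Visits.Spec d emitFace emitFace-cost M β β≥ 1≤n
    module VisitMarked = Visits.Spec d emitMarked emitMarked-cost M β β≥ 1≤n
    open VisitFace using (Slot; env-keeps)

    wp-guard : ∀ {R k ls X c t Q} → Env R → Pointwise (Holds R) ls X →
               (∀ R₁ → SameFrom 7 R R₁ → Ind k X → WP R₁ c t Q) →
               (∀ R₁ → SameFrom 7 R R₁ → ¬ Ind k X → Q R₁) →
               WP R (guard k ls c) (1 + (test-cost k ls * suc m + (2 + t))) Q
    wp-guard {R} {k} {ls} {X} {c} {t} {Q} env hs on-yes on-no =
      wp-seq (wp-block (wp-seq (wp-mono ≤-refl branch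
        (wp-test k (env-same (sameFrom λ _ → refl) env) (holds-same {R} {R₀} (sameFrom λ _ → refl) hs)))))
      where
      R₀ : Memory
      R₀ = execs (const 5 0 ∷ []) R
      branch : ∀ R₁ → TestPost R₀ (Ind k X) R₁ → WP R₁ (ifz 5 (block []) c) (2 + t) Q
      branch R₁ (same , inj₁ (i , e)) = wp-ifz (λ z → absurd (trans (sym e) z)) (λ _ → on-yes R₁ same₁ i)
        where
        absurd : ∀ {A : Set} → 1 ≡ 0 → A
        absurd ()
        same₁ : SameFrom 7 R R₁
        same₁ = sameFrom (same-at same)
      branch R₁ (same , inj₂ (¬i , e)) =
        wp-ifz (λ _ → wp-mono z≤n (λ _ → id) (wp-block (on-no R₁ (sameFrom (same-at same)) ¬i))) (λ nz → ⊥-elim (nz e))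

    wp-output : ∀ {R p ls X} ps → 15 + d ≤ p → R 9 ≡ p → Pointwise (Slot 0 R) ls X →
                All (λ q → 7 + q < p × q ≢ 2) ps →
                WP R (block (output-ops ps ls)) (length (output-ops ps ls))
                  (Emitted 10 R p (map (λ q → R (7 + q)) ps ++ encodeFace X))
    wp-output {R} {p} {ls} {X} ps p≥ e9 slots ps< =
      wp-block (subst (λ ws → Emitted 10 R p ws _) values (emitted-after k₁
        (exec-puts (map (7 +_) ps ++ 1 ∷ map (7 +_) ls) e9 refl (≤-trans (m≤m+n 10 (5 + d)) p≥)
          (All.++⁺ (All.map⁺ (All.map (λ { (l , ne) → l , λ e → ne (+-cancelˡ-≡ 7 _ 2 e) }) ps<))
            ((≤-trans (m≤m+n 2 _) p≥ , λ ()) ∷ All.map⁺ (ls< slots))))))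
      where
      R₁ : Memory
      R₁ = execs (const 0 1 ∷ const 1 (length ls) ∷ []) R
      k₁ : Keeps 10 p R R₁
      k₁ = keeps λ { (suc (suc a)) _ _ → refl ; (suc zero) (s≤s ()) _ }
      ls< : ∀ {ls X} → Pointwise (Slot 0 R) ls X → All (λ l → 7 + l < p × 7 + l ≢ 9) ls
      ls< [] = []
      ls< (((l , u) , _) ∷ s) =
        (≤-trans (+-monoʳ-≤ 8 u) (≤-trans (m≤n+m _ 4) p≥) , >⇒≢ (+-monoʳ-≤ 7 l)) ∷ ls< s
      values-ls : ∀ {ls X} → Pointwise (Slot 0 R) ls X → map R₁ (map (7 +_) ls) ≡ map toℕ X
      values-ls []            = refl
      values-ls ((_ , h) ∷ s) = cong₂ _∷_ h (values-ls s)
      values-ps : ∀ ps → map R₁ (map (7 +_) ps) ≡ map (λ q → R (7 + q)) ps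
      values-ps []       = refl
      values-ps (q ∷ ps) = cong (R (7 + q) ∷_) (values-ps ps)
      values : map R₁ (map (7 +_) ps ++ 1 ∷ map (7 +_) ls) ≡ map (λ q → R (7 + q)) ps ++ encodeFace X
      values = trans (map-++ R₁ (map (7 +_) ps) _)
        (cong₂ _++_ (values-ps ps) (cong₂ _∷_ (Pointwise.Pointwise-length slots) (values-ls slots)))

    p≥15 : ∀ {p} → 7 + (β + m * n) ≤ p → 15 + d ≤ p
    p≥15 end≤p = ≤-trans (+-monoʳ-≤ 7 (≤-trans β≥ (m≤m+n β (m * n)))) end≤p

    slots-same : ∀ {h R R′ ls X} → h ≤ 10 → SameFrom h R R′ → Pointwise (Slot 0 R) ls X → Pointwise (Slot 0 R′) ls X
    slots-same {h} {R} {R′} h≤ same = Pointwise.map λ { {l} ((lo , hi) , e) → (lo , hi) ,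
      trans (kept {h} (same⇒keeps {hi = 8 + l} ≤-refl same) (7 + l) (≤-trans h≤ (+-monoʳ-≤ 7 lo)) ≤-refl) e }

    slots-holds : ∀ {R ls X} → Pointwise (Slot 0 R) ls X → Pointwise (Holds R) ls X
    slots-holds = Pointwise.map proj₂

    -- The factor 1 takes the place of the n in the marked version, so that one estimate of the
    -- total serves both programs.
    wp-emitFace : VisitFace.EmitSpec (suc m * 1) faceWords
    wp-emitFace {R} {p} {ls} {X} env end≤p e9 slots = wp-mono cost≤ (λ _ → id)
      (wp-guard {k = length ls} env (slots-holds {R} slots) on-yes on-no)
      where
      len : length ls ≡ length X
      len = Pointwise.Pointwise-length slots
      on-yes : ∀ R₁ → SameFrom 7 R R₁ → Ind (length ls) X →
             WP R₁ (block (output-ops [] ls)) (length (output-ops [] ls)) (Emitted 10 R p (faceWords X))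
      on-yes R₁ same i rewrite len | dec-true (ind? (length X) X) i = wp-mono
        (≤-reflexive (cong (λ k → length (const 0 1 ∷ const 1 k ∷ puts (1 ∷ map (7 +_) ls))) len)) (λ _ → emitted-after (same⇒keeps (m≤m+n 7 3) same))
        (subst (λ k → WP R₁ (block (const 0 1 ∷ const 1 k ∷ puts (1 ∷ map (7 +_) ls))) _ _) len
        (wp-output [] (p≥15 end≤p) (trans (same-at same 2) e9) (slots-same (m≤m+n 7 3) same slots) []))
      on-no : ∀ R₁ → SameFrom 7 R R₁ → ¬ Ind (length ls) X → Emitted 10 R p (faceWords X) R₁
      on-no R₁ same ¬i rewrite len | dec-false (ind? (length X) X) ¬i =
        emitted-[] (trans (same-at same 2) e9) (same⇒keeps (m≤m+n 7 3) same)
      cost≤ : 1 + (test-cost (length ls) ls * suc m + (2 + length (output-ops [] ls))) ≤ emitFace-cost ls * (suc m * 1)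
      cost≤ rewrite *-identityʳ m = +-scaled 1 (test-cost (length ls) ls + c₁) (suc m) (≤-scaled 1 (s≤s z≤n))
        (+-scaled (test-cost (length ls) ls) c₁ (suc m) ≤-refl (≤-scaled c₁ (s≤s z≤n)))
        where
        c₁ : ℕ
        c₁ = 2 + length (output-ops [] ls)

    -- Columns k and above have been tried as extensions. Register 7 is both loop counter and
    -- candidate column, which is why the test runs on `0 ∷ ls`.
    record MaximalScan (R : Memory) (X : List (Fin n)) (k : ℕ) (R′ : Memory) : Set where
      field
        k≤n     : k ≤ n
        counter : R′ 7 ≡ k
        same    : SameFrom 9 R R′
        verdict : (R′ 8 ≡ 1 × (∀ y → k ≤ toℕ y → ¬ Ind (suc (length X)) (y ∷ X))) ⊎
                  (R′ 8 ≡ 0 × ∃[ y ] Ind (suc (length X)) (y ∷ X))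

    scanned : ∀ {R X R′} → MaximalScan R X 0 R′ → R′ 8 ≡ bit (does (maximal? X))
    scanned {X = X} s with MaximalScan.verdict s
    ... | inj₁ (e , none) rewrite dec-true (maximal? X) (λ y → none y z≤n) = e
    ... | inj₂ (e , y , i) rewrite dec-false (maximal? X) (λ none → none y i) = e

    wp-emitMarked : VisitMarked.EmitSpec (suc m * n) markedWords
    wp-emitMarked {R} {p} {ls} {X} env end≤p e9 slots = wp-mono cost≤ (λ _ → id)
      (wp-guard {k = length ls} env (slots-holds {R} slots) on-yes on-no)
      where
      len : length ls ≡ length X
      len = Pointwise.Pointwise-length slots
      tc : ℕ
      tc = test-cost (suc (length ls)) (0 ∷ ls)
      body : Cmd
      body = block (const 0 1 ∷ sub 7 7 0 ∷ []) ⨾ guard (suc (length ls)) (0 ∷ ls) (block (const 8 0 ∷ []))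
      out : Cmd
      out = block (output-ops (1 ∷ []) ls)
      wp-body : ∀ {k R₁} → MaximalScan R X (suc k) R₁ → WP R₁ body (2 + (1 + (tc * suc m + 3))) (MaximalScan R X k)
      wp-body {k} {R₁} s = wp-seq (wp-block (wp-guard {R₂} {suc (length ls)} {X = y ∷ X}
        (env-keeps (m≤m+n 9 (2 + d)) end≤p (same⇒keeps ≤-refl same₂) env)
        (counter₂ ∷ slots-holds {R₂} (slots-same (m≤m+n 9 1) same₂ slots)) on-yes′ on-no′))
        where
        y : Fin n
        y = fromℕ< (MaximalScan.k≤n s)
        y≡k : toℕ y ≡ k
        y≡k = Fin.toℕ-fromℕ< (MaximalScan.k≤n s)
        R₂ : Memory
        R₂ = execs (const 0 1 ∷ sub 7 7 0 ∷ []) R₁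
        same₂ : SameFrom 9 R R₂
        same₂ = sameFrom (same-at (MaximalScan.same s))
        counter₂ : R₂ 7 ≡ toℕ y
        counter₂ = trans (cong (_∸ 1) (MaximalScan.counter s)) (sym y≡k)
        on-yes′ : ∀ R₃ → SameFrom 7 R₂ R₃ → Ind (suc (length ls)) (y ∷ X) →
                WP R₃ (block (const 8 0 ∷ [])) 1 (MaximalScan R X k)
        on-yes′ R₃ same₃ i = wp-block (record
          { k≤n     = <⇒≤ (MaximalScan.k≤n s)
          ; counter = trans (same-at same₃ 0) (trans counter₂ y≡k)
          ; same    = sameFrom λ a → trans (same-at same₃ (2 + a)) (same-at same₂ a)
          ; verdict = inj₂ (refl , y , subst (λ q → Ind (suc q) (y ∷ X)) len i) })
        on-no′ : ∀ R₃ → SameFrom 7 R₂ R₃ → ¬ Ind (suc (length ls)) (y ∷ X) → MaximalScan R X k R₃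
        on-no′ R₃ same₃ ¬i = record
          { k≤n     = <⇒≤ (MaximalScan.k≤n s)
          ; counter = trans (same-at same₃ 0) (trans counter₂ y≡k)
          ; same    = sameFrom λ a → trans (same-at same₃ (2 + a)) (same-at same₂ a)
          ; verdict = extend (MaximalScan.verdict s) }
          where
          extend : (R₁ 8 ≡ 1 × (∀ y → suc k ≤ toℕ y → ¬ Ind (suc (length X)) (y ∷ X))) ⊎
                   (R₁ 8 ≡ 0 × ∃[ y ] Ind (suc (length X)) (y ∷ X)) →
                   (R₃ 8 ≡ 1 × (∀ y → k ≤ toℕ y → ¬ Ind (suc (length X)) (y ∷ X))) ⊎
                   (R₃ 8 ≡ 0 × ∃[ y ] Ind (suc (length X)) (y ∷ X))
          extend (inj₂ (e , w))    = inj₂ (trans (same-at same₃ 1) e , w)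
          extend (inj₁ (e , none)) = inj₁ (trans (same-at same₃ 1) e , none′)
            where
            none′ : ∀ y → k ≤ toℕ y → ¬ Ind (suc (length X)) (y ∷ X)
            none′ z le with k ≟ toℕ z
            ... | no ne  = none z (≤∧≢⇒< le ne)
            ... | yes eq with Fin.toℕ-injective (trans y≡k eq)
            ...   | refl = λ i → ¬i (subst (λ q → Ind (suc q) (y ∷ X)) (sym len) i)
      on-yes : ∀ R₁ → SameFrom 7 R R₁ → Ind (length ls) X →
             WP R₁ (block (const 8 1 ∷ const 0 0 ∷ add 7 (11 + d) 0 ∷ []) ⨾ while 7 body ⨾ out)
               (3 + ((n * (2 + (2 + (1 + (tc * suc m + 3)))) + 1) + length (output-ops (1 ∷ []) ls)))
               (Emitted 10 R p (markedWords X))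
      on-yes R₁ same₁ i = wp-seq (wp-block (wp-seq (wp-mono ≤-refl print
        (wp-while (MaximalScan R X) MaximalScan.counter wp-body n (record
          { k≤n     = ≤-refl
          ; counter = trans (+-identityʳ _) (trans (same-at same₁ (4 + d)) (n-reg env))
          ; same    = sameFrom λ a → same-at same₁ (2 + a)
          ; verdict = inj₁ (refl , λ y le → ⊥-elim (<⇒≱ (Fin.toℕ<n y) le)) })))))
        where
        print : ∀ R₂ → MaximalScan R X 0 R₂ →
                WP R₂ out (length (output-ops (1 ∷ []) ls)) (Emitted 10 R p (markedWords X))
        print R₂ s = wp-mono ≤-refl
          (λ R₃ e → subst (λ ws → Emitted 10 R p ws R₃) words≡
            (emitted-after (same⇒keeps (m≤m+n 9 1) (MaximalScan.same s)) e))
          (wp-output (1 ∷ []) (p≥15 end≤p) (trans (same-at (MaximalScan.same s) 0) e9)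
            (slots-same (m≤m+n 9 1) (MaximalScan.same s) slots)
            ((≤-trans (m≤m+n 9 _) (p≥15 end≤p) , λ ()) ∷ []))
          where
          words≡ : R₂ 8 ∷ encodeFace X ≡ markedWords X
          words≡ rewrite dec-true (ind? (length X) X) (subst (λ q → Ind q X) len i) =
            cong (_∷ encodeFace X) (scanned s)
      on-no : ∀ R₁ → SameFrom 7 R R₁ → ¬ Ind (length ls) X → Emitted 10 R p (markedWords X) R₁
      on-no R₁ same ¬i rewrite len | dec-false (ind? (length X) X) ¬i =
        emitted-[] (trans (same-at same 2) e9) (same⇒keeps (m≤m+n 7 3) same)
      σ : ℕ
      σ = suc m * n
      1≤σ : 1 ≤ σ
      1≤σ = *-mono-≤ (s≤s (z≤n {m})) 1≤n
      cost≤ : 1 + (test-cost (length ls) ls * suc m + (2 + (3 +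
                ((n * (2 + (2 + (1 + (tc * suc m + 3)))) + 1) + length (output-ops (1 ∷ []) ls))))) ≤
              emitMarked-cost ls * σ
      cost≤ = +-scaled 1 (c₀ + (2 + (3 + c₁))) σ (≤-scaled 1 1≤σ)
        (+-scaled c₀ (2 + (3 + c₁)) σ (*-monoʳ-≤ c₀ (m≤m*n (suc m) n {{>-nonZero 1≤n}}))
        (+-scaled 2 (3 + c₁) σ (≤-scaled 2 1≤σ) (+-scaled 3 c₁ σ (≤-scaled 3 1≤σ)
        (+-scaled (8 + tc + 1) c₂ σ (+-scaled (8 + tc) 1 σ loop (≤-scaled 1 1≤σ)) (≤-scaled c₂ 1≤σ)))))
        where
        c₀ c₁ c₂ : ℕ
        c₀ = test-cost (length ls) ls
        c₂ = length (output-ops (1 ∷ []) ls)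
        c₁ = 8 + tc + 1 + c₂
        open ≤-Reasoning
        loop : n * (2 + (2 + (1 + (tc * suc m + 3)))) ≤ (8 + tc) * σ
        loop = begin
          n * (5 + (tc * suc m + 3))   ≡⟨ cong (λ q → n * (5 + q)) (+-comm (tc * suc m) 3) ⟩
          n * (8 + tc * suc m)         ≤⟨ *-monoʳ-≤ n (+-monoˡ-≤ (tc * suc m) (≤-scaled 8 (s≤s (z≤n {m})))) ⟩
          n * (8 * suc m + tc * suc m) ≡⟨ cong (n *_) (sym (*-distribʳ-+ (suc m) 8 tc)) ⟩
          n * ((8 + tc) * suc m)       ≡⟨ *-comm n _ ⟩
          (8 + tc) * suc m * n         ≡⟨ *-assoc (8 + tc) (suc m) n ⟩
          (8 + tc) * σ                 ∎

    length-puts-face : ∀ ps {ls : List ℕ} {X : List (Fin n)} → length ls ≡ length X →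
      length ps + length (encodeFace X) ≤ length (output-ops ps ls)
    length-puts-face ps {ls} {X} len = begin
      length ps + suc (length (map toℕ X))   ≡⟨ cong₂ (λ a b → a + suc b) (sym (length-map (7 +_) ps))
                                                  (trans (length-map toℕ X) (trans (sym len) (sym (length-map (7 +_) ls)))) ⟩
      length (map (7 +_) ps) + suc (length (map (7 +_) ls)) ≡⟨ sym (length-++ (map (7 +_) ps)) ⟩
      length rs                             ≤⟨ m≤m*n (length rs) 2 ⟩
      length rs * 2                         ≡⟨ sym (length-puts rs) ⟩
      length (puts rs)                      ≤⟨ m≤n+m _ 2 ⟩
      length (output-ops ps ls)             ∎
      where
      open ≤-Reasoning
      rs : List ℕ
      rs = map (7 +_) ps ++ 1 ∷ map (7 +_) ls

    faceWords-length : ∀ ls X → length ls ≡ length X → length (faceWords X) ≤ emitFace-cost ls * (suc m * 1)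
    faceWords-length ls X len = ≤-trans (≤-trans bound
      (≤-trans (length-puts-face [] {ls} {X} len) (≤-trans (m≤n+m _ 2) (≤-trans (m≤n+m _ (test-cost (length ls) ls)) (m≤n+m _ 1)))))
      (≤-scaled (emitFace-cost ls) {suc m * 1} (s≤s z≤n))
      where
      bound : length (faceWords X) ≤ length (encodeFace X)
      bound with does (ind? (length X) X)
      ... | true  = ≤-refl
      ... | false = z≤n

    markedWords-length : ∀ ls X → length ls ≡ length X → length (markedWords X) ≤ emitMarked-cost ls * (suc m * n)
    markedWords-length ls X len = ≤-trans (≤-trans bound
      (≤-trans (length-puts-face (1 ∷ []) {ls} {X} len)
        (≤-trans (m≤n+m _ (8 + test-cost (suc (length ls)) (0 ∷ ls) + 1))
        (≤-trans (m≤n+m _ 3) (≤-trans (m≤n+m _ 2) (≤-trans (m≤n+m _ (test-cost (length ls) ls)) (m≤n+m _ 1)))))))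
      (≤-scaled (emitMarked-cost ls) (*-mono-≤ (s≤s (z≤n {m})) 1≤n))
      where
      bound : length (markedWords X) ≤ suc (length (encodeFace X))
      bound with does (ind? (length X) X)
      ... | true  = ≤-refl
      ... | false = z≤n


-- Moving blocks of memory

seg-lookup : ∀ {R R′ p q ws} → Seg R p ws → Seg R′ q ws → ∀ i → i < length ws → R (p + i) ≡ R′ (q + i)
seg-lookup {R} {R′} {p} {q} (e ∷ s) (e′ ∷ s′) zero h =
  trans (cong R (+-identityʳ p)) (trans e (trans (sym e′) (cong R′ (sym (+-identityʳ q)))))
seg-lookup {R} {R′} {p} {q} (e ∷ s) (e′ ∷ s′) (suc i) (s≤s h) =
  trans (cong R (+-suc p i)) (trans (seg-lookup s s′ i h) (cong R′ (sym (+-suc q i))))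

seg-map : ∀ {R R′ p q ws} → Seg R p ws → (∀ i → i < length ws → R′ (q + i) ≡ R (p + i)) → Seg R′ q ws
seg-map [] f = []
seg-map {R} {R′} {p} {q} (e ∷ s) f =
  trans (trans (cong R′ (sym (+-identityʳ q))) (trans (f 0 (s≤s z≤n)) (cong R (+-identityʳ p)))) e ∷
  seg-map s (λ i h → trans (cong R′ (sym (+-suc q i))) (trans (f (suc i) (s≤s h)) (cong R (+-suc p i))))

seg-output : ∀ {R p ws} → Seg R p ws → applyUpTo (λ i → R (p + i)) (length ws) ≡ ws
seg-output [] = refl
seg-output {R} {p} {w ∷ ws} (e ∷ s) = cong₂ _∷_ (trans (cong R (+-identityʳ p)) e)
  (trans (applyUpTo-cong (length ws) (λ i → cong R (+-suc p i))) (seg-output s))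
  where
  applyUpTo-cong : ∀ {f g : ℕ → ℕ} k → (∀ i → f i ≡ g i) → applyUpTo f k ≡ applyUpTo g k
  applyUpTo-cong zero    eq = refl
  applyUpTo-cong (suc k) eq = cong₂ _∷_ (eq 0) (applyUpTo-cong k (eq ∘ suc))

copy-ops : List Op
copy-ops = sub 3 3 0 ∷ load 6 4 ∷ store 9 6 ∷ add 9 9 0 ∷ add 4 4 0 ∷ []

copy : Cmd
copy = while 3 (block copy-ops)

-- Register 2 is singled out because it carries the base address of the result across the final copy
-- to `gather`.
record Copied (R : Memory) (s q i : ℕ) (R′ : Memory) : Set where
  field
    ptr    : R′ 9 ≡ q + i
    r2     : R′ 2 ≡ R 2
    copied : ∀ j → j < i → R′ (q + j) ≡ R (s + j)
    other  : ∀ a → 10 ≤ a → a < q ⊎ q + i ≤ a → R′ a ≡ R a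

record Copying (R : Memory) (s q k j : ℕ) (R′ : Memory) : Set where
  field
    i       : ℕ
    i+j     : i + j ≡ k
    counter : R′ 3 ≡ j
    source  : R′ 4 ≡ s + i
    one     : R′ 0 ≡ 1
    result  : Copied R s q i R′

-- Copying in ascending order tolerates an overlap when the target does not start above the source:
-- every cell is read before it is overwritten.
copy-step : ∀ {R s q k j R′} → 10 ≤ s → 10 ≤ q → s + k ≤ q ⊎ q ≤ s →
            Copying R s q k (suc j) R′ → Copying R s q k j (execs copy-ops R′)
copy-step {R} {s} {q} {k} {j} {R′} 10≤s 10≤q disjoint c = record
  { i       = suc i
  ; i+j     = trans (sym (+-suc i j)) (Copying.i+j c)
  ; counter = trans (Put.other put 3 (<⇒≢ (<-≤-trans (m≤m+n 4 6) 10≤q+i)) (λ ())) (cong₂ _∸_ (Copying.counter c) (Copying.one c))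
  ; source  = trans (cong₂ _+_ (trans (Put.other put 4 (<⇒≢ (<-≤-trans (m≤m+n 5 5) 10≤q+i)) (λ ())) (Copying.source c)) one′)
                (trans (+-comm (s + i) 1) (sym (+-suc s i)))
  ; one     = one′
  ; result  = record
      { ptr    = trans (Put.ptr put) (sym (+-suc q i))
      ; r2     = trans (Put.other put 2 (<⇒≢ (<-≤-trans (m≤m+n 3 7) 10≤q+i)) (λ ())) (Copied.r2 result)
      ; copied = copied′
      ; other  = other′ } }
  where
  open Copying c using (i; result)
  A B P : Memory
  A = execs (sub 3 3 0 ∷ load 6 4 ∷ []) R′
  B = write R′ 3 (R′ 3 ∸ R′ 0)
  P = execs (store 9 6 ∷ add 9 9 0 ∷ []) A
  10≤q+i : 10 ≤ q + i
  10≤q+i = ≤-trans 10≤q (m≤m+n q i)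
  i<k : i < k
  i<k = subst (i <_) (Copying.i+j c) (m<m+n i (s≤s z≤n))
  put : Put A (q + i) (A 6) P
  put = exec-put 6 (Copied.ptr result) (Copying.one c) 10≤q+i
  one′ : P 0 ≡ 1
  one′ = trans (Put.other put 0 (<⇒≢ (<-≤-trans (m≤m+n 1 9) 10≤q+i)) (λ ())) (Copying.one c)
  final-≢ : ∀ {a} → 10 ≤ a → execs copy-ops R′ a ≡ P a
  final-≢ h = write-≢ P _ (>⇒≢ (<-≤-trans (m≤m+n 5 5) h))
  A-≢ : ∀ {a} → 10 ≤ a → A a ≡ R′ a
  A-≢ h = trans (write-≢ B _ (>⇒≢ (<-≤-trans (m≤m+n 7 3) h))) (write-≢ R′ _ (>⇒≢ (<-≤-trans (m≤m+n 4 6) h)))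
  fresh : s + k ≤ q ⊎ q ≤ s → s + i < q ⊎ q + i ≤ s + i
  fresh (inj₁ h) = inj₁ (<-≤-trans (+-monoʳ-< s i<k) h)
  fresh (inj₂ h) = inj₂ (+-monoˡ-≤ i h)
  10≤s+i : 10 ≤ s + i
  10≤s+i = ≤-trans 10≤s (m≤m+n s i)
  loaded : A 6 ≡ R (s + i)
  loaded = trans (cong B (Copying.source c))
    (trans (write-≢ R′ _ (>⇒≢ (<-≤-trans (m≤m+n 4 6) 10≤s+i))) (Copied.other result (s + i) 10≤s+i (fresh disjoint)))
  copied′ : ∀ l → l < suc i → execs copy-ops R′ (q + l) ≡ R (s + l)
  copied′ l (s≤s l≤i) with l ≟ i
  ... | yes refl = trans (final-≢ 10≤q+i) (trans (Put.value put) loaded)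
  ... | no l≢i   = trans (final-≢ 10≤q+l) (trans (Put.other put (q + l) (l≢i ∘ +-cancelˡ-≡ q l i) (>⇒≢ 10≤q+l))
      (trans (A-≢ 10≤q+l) (Copied.copied result l (≤∧≢⇒< l≤i l≢i))))
    where
    10≤q+l : 10 ≤ q + l
    10≤q+l = ≤-trans 10≤q (m≤m+n q l)
  other′ : ∀ a → 10 ≤ a → a < q ⊎ q + suc i ≤ a → execs copy-ops R′ a ≡ R a
  other′ a h w = trans (final-≢ h) (trans (Put.other put a (outside w) (>⇒≢ h))
    (trans (A-≢ h) (Copied.other result a h (weaken w))))
    where
    outside : a < q ⊎ q + suc i ≤ a → a ≢ q + i
    outside (inj₁ l) = <⇒≢ (≤-trans l (m≤m+n q i))
    outside (inj₂ g) = >⇒≢ (≤-trans (≤-reflexive (sym (+-suc q i))) g)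
    weaken : a < q ⊎ q + suc i ≤ a → a < q ⊎ q + i ≤ a
    weaken (inj₁ l) = inj₁ l
    weaken (inj₂ g) = inj₂ (≤-trans (+-monoʳ-≤ q (n≤1+n i)) g)

wp-copy : ∀ {R s q} k → R 0 ≡ 1 → R 3 ≡ k → R 4 ≡ s → R 9 ≡ q → 10 ≤ s → 10 ≤ q →
          s + k ≤ q ⊎ q ≤ s → WP R copy (k * 7 + 1) (Copied R s q k)
wp-copy {R} {s} {q} k e0 e3 e4 e9 10≤s 10≤q disjoint = wp-mono ≤-refl end
  (wp-while (Copying R s q k) Copying.counter (λ c → wp-block (copy-step 10≤s 10≤q disjoint c)) k (record
    { i = 0 ; i+j = refl ; counter = e3 ; source = trans e4 (sym (+-identityʳ s)) ; one = e0
    ; result = record { ptr = trans e9 (sym (+-identityʳ q)) ; r2 = refl ; copied = λ _ () ; other = λ _ _ _ → refl } }))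
  where
  end : ∀ R′ → Copying R s q k 0 R′ → Copied R s q k R′
  end R′ c = subst (λ l → Copied R s q l R′) (trans (sym (+-identityʳ _)) (Copying.i+j c)) (Copying.result c)

-- Restores values that the control flow has determined; in each leaf of the branching they are
-- compile-time constants.
put-consts : List ℕ → List Op
put-consts []       = []
put-consts (b ∷ bs) = const 6 b ∷ store 9 6 ∷ add 9 9 0 ∷ put-consts bs

length-put-consts : ∀ bs → length (put-consts bs) ≡ length bs * 3
length-put-consts []       = refl
length-put-consts (_ ∷ bs) = cong (3 +_) (length-put-consts bs)

record PutConsts (R : Memory) (p : ℕ) (bs : List ℕ) (R′ : Memory) : Set where
  field
    seg   : Seg R′ p bs
    ptr   : R′ 9 ≡ p + length bs
    below : ∀ a → a < p → a ≢ 6 → a ≢ 9 → R′ a ≡ R a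

exec-put-consts : ∀ {R p} bs → R 0 ≡ 1 → R 9 ≡ p → 10 ≤ p → PutConsts R p bs (execs (put-consts bs) R)
exec-put-consts {p = p} [] e0 e9 10≤p = record
  { seg = [] ; ptr = trans e9 (sym (+-identityʳ p)) ; below = λ _ _ _ _ → refl }
exec-put-consts {R} {p} (b ∷ bs) e0 e9 10≤p = record
  { seg   = trans (PutConsts.below ih p ≤-refl (>⇒≢ (<-≤-trans (m≤m+n 7 3) 10≤p)) (>⇒≢ 10≤p)) (Put.value put) ∷
            PutConsts.seg ih
  ; ptr   = trans (PutConsts.ptr ih) (sym (+-suc p _))
  ; below = λ a h a≢6 a≢9 → trans (PutConsts.below ih a (m≤n⇒m≤1+n h) a≢6 a≢9)
              (trans (Put.other put a (<⇒≢ h) a≢9) (write-≢ R b a≢6)) }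
  where
  put : Put (write R 6 b) p b (execs (const 6 b ∷ store 9 6 ∷ add 9 9 0 ∷ []) R)
  put = exec-put {write R 6 b} 6 e9 e0 10≤p
  ih : PutConsts _ (suc p) bs (execs (put-consts (b ∷ bs)) R)
  ih = exec-put-consts bs
    (trans (Put.other put 0 (<⇒≢ (<-≤-trans (m≤m+n 1 9) 10≤p)) (λ ())) e0) (Put.ptr put) (m≤n⇒m≤1+n 10≤p)

put-addresses : ℕ → List Op
put-addresses zero    = []
put-addresses (suc k) = const (suc k) (suc k) ∷ add (suc k) (suc k) 0 ∷ put-addresses k

load-all : ℕ → List Op
load-all zero    = []
load-all (suc k) = load k k ∷ load-all k

length-put-addresses : ∀ k → length (put-addresses k) ≡ k * 2
length-put-addresses zero    = refl
length-put-addresses (suc k) = cong (2 +_) (length-put-addresses k)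

length-load-all : ∀ k → length (load-all k) ≡ k
length-load-all zero    = refl
length-load-all (suc k) = cong suc (length-load-all k)

-- Register 0 holds the base S throughout, and S is already the address belonging to register 0.
exec-put-addresses : ∀ {R S} k → R 0 ≡ S → let R′ = execs (put-addresses k) R in
  (∀ j → j ≤ k → R′ j ≡ j + S) × (∀ j → k < j → R′ j ≡ R j)
exec-put-addresses zero e0 = (λ { zero z≤n → e0 }) , λ _ _ → refl
exec-put-addresses {R} {S} (suc k) e0 with exec-put-addresses {write R₁ (suc k) (R₁ (suc k) + R₁ 0)} {S} k e0
  where
  R₁ : Memory
  R₁ = write R (suc k) (suc k)
... | ih , ih′ = low , λ j h → trans (ih′ j (<-trans ≤-refl h)) (trans (write-≢ R₁ _ (>⇒≢ h)) (write-≢ R _ (>⇒≢ h)))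
  where
  R₁ : Memory
  R₁ = write R (suc k) (suc k)
  low : ∀ j → j ≤ suc k → _
  low j h with j ≟ suc k
  ... | no ne    = ih j (s≤s⁻¹ (≤∧≢⇒< h ne))
  ... | yes refl = trans (ih′ (suc k) ≤-refl) (trans (write-≡ R₁ (suc k) _)
                     (cong₂ _+_ (write-≡ R (suc k) (suc k)) e0))

-- All sources lie at S or above, hence outside the registers being filled, so no load destroys a
-- value that is still to be read.
exec-load-all : ∀ {R S} k → k ≤ S → (∀ j → j < k → R j ≡ j + S) → let R′ = execs (load-all k) R in
  (∀ j → j < k → R′ j ≡ R (j + S)) × (∀ j → k ≤ j → R′ j ≡ R j)
exec-load-all zero k≤S addr = (λ _ ()) , λ _ _ → refl
exec-load-all {R} {S} (suc k) k<S addr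
  with exec-load-all {write R k (R (R k))} {S} k (<⇒≤ k<S) (λ j h → trans (write-≢ R _ (<⇒≢ h)) (addr j (m≤n⇒m≤1+n h)))
... | ih , ih′ = low , λ j h → trans (ih′ j (<⇒≤ h)) (write-≢ R _ (>⇒≢ h))
  where
  low : ∀ j → j < suc k → _
  low j h with j ≟ k
  ... | no ne    = trans (ih j (≤∧≢⇒< (s≤s⁻¹ h) ne)) (write-≢ R _ (>⇒≢ (≤-trans k<S (m≤n+m S j))))
  ... | yes refl = trans (ih′ k ≤-refl) (trans (write-≡ R k _) (cong R (addr k ≤-refl)))

listMem-++ˡ : ∀ xs ys k → k < length xs → listMem (xs ++ ys) k ≡ listMem xs k
listMem-++ˡ (x ∷ xs) ys zero    h       = refl
listMem-++ˡ (x ∷ xs) ys (suc k) (s≤s h) = listMem-++ˡ xs ys k h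

listMem-++ʳ : ∀ xs ys k → listMem (xs ++ ys) (length xs + k) ≡ listMem ys k
listMem-++ʳ []       ys k = refl
listMem-++ʳ (x ∷ xs) ys k = listMem-++ʳ xs ys k

listMem-tabulate : ∀ {n} (f : Fin n → ℕ) j → listMem (tabulate f) (toℕ j) ≡ f j
listMem-tabulate f Fin.zero    = refl
listMem-tabulate f (Fin.suc j) = listMem-tabulate (f ∘ Fin.suc) j

listMem-matrix : ∀ {m n} (f : Fin m → Fin n → ℕ) i j →
  listMem (concat (tabulate λ i → tabulate (f i))) (toℕ i * n + toℕ j) ≡ f i j
listMem-matrix {suc m} {n} f Fin.zero j = trans
  (listMem-++ˡ (tabulate (f Fin.zero)) _ (toℕ j) (subst (toℕ j <_) (sym (length-tabulate (f Fin.zero))) (Fin.toℕ<n j)))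
  (listMem-tabulate (f Fin.zero) j)
listMem-matrix {suc m} {n} f (Fin.suc i) j = trans
  (cong (listMem (concat (tabulate λ i → tabulate (f i))))
    (trans (+-assoc n (toℕ i * n) (toℕ j)) (cong (_+ (toℕ i * n + toℕ j)) (sym (length-tabulate (f Fin.zero))))))
  (trans (listMem-++ʳ (tabulate (f Fin.zero)) _ (toℕ i * n + toℕ j)) (listMem-matrix (f ∘ Fin.suc) i j))

-- The quantifier also covers positions past the end, where memory reads 0: exactly 13 + d registers
-- are inspected even if the matrix has fewer cells.
Bits : List ℕ → Set
Bits xs = ∀ k → listMem xs k ≡ 0 ⊎ listMem xs k ≡ 1

bits-++ : ∀ xs ys → Bits xs → Bits ys → Bits (xs ++ ys)
bits-++ []       ys p q k       = q k
bits-++ (x ∷ xs) ys p q zero    = p zero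
bits-++ (x ∷ xs) ys p q (suc k) = bits-++ xs ys (p ∘ suc) q k

bits-tabulate : ∀ {n} (f : Fin n → Bool) → Bits (tabulate (λ j → bit (f j)))
bits-tabulate {zero}  f k = inj₁ refl
bits-tabulate {suc n} f zero with f Fin.zero
... | true  = inj₂ refl
... | false = inj₁ refl
bits-tabulate {suc n} f (suc k) = bits-tabulate (f ∘ Fin.suc) k

bits-matrix : ∀ {m n} (M : Matrix m n) → Bits (concat (tabulate λ i → tabulate λ j → bit (M i j)))
bits-matrix {zero}  M k = inj₁ refl
bits-matrix {suc m} M   = bits-++ (tabulate λ j → bit (M Fin.zero j)) _ (bits-tabulate (M Fin.zero)) (bits-matrix (M ∘ Fin.suc))

-- The matrix occupies the registers that a program can address directly.  Before anything is
-- overwritten, branching on the bits in registers 2, …, k + 1 moves them into the program counter.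
readBits : (List ℕ → Cmd) → ℕ → List ℕ → Cmd
readBits leaf zero    bs = leaf bs
readBits leaf (suc k) bs = ifz (2 + k) (readBits leaf k (0 ∷ bs)) (readBits leaf k (1 ∷ bs))

-- The code contains one copy of the leaf for each of the 2 ^ k bit patterns, but a run executes
-- only one, at two steps per bit and without writing to memory before it is reached.
wp-readBits : ∀ {R leaf t Q} k bs → (∀ j → R (2 + j) ≡ 0 ⊎ R (2 + j) ≡ 1) → Seg R (2 + k) bs →
              (∀ bs′ → length bs′ ≡ k + length bs → Seg R 2 bs′ → WP R (leaf bs′) t Q) →
              WP R (readBits leaf k bs) (k * 2 + t) Q
wp-readBits zero    bs bits seg wp-leaf = wp-leaf bs refl seg
wp-readBits {R} {leaf} {t} {Q} (suc k) bs bits seg wp-leaf = wp-ifz (λ z → next 0 z) (λ nz → next 1 (one nz (bits k)))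
  where
  next : ∀ b → R (2 + k) ≡ b → WP R (readBits leaf k (b ∷ bs)) (k * 2 + t) Q
  next b e = wp-readBits k (b ∷ bs) bits (e ∷ seg) (λ bs′ eq → wp-leaf bs′ (trans eq (+-suc k (length bs))))
  one : R (2 + k) ≢ 0 → R (2 + k) ≡ 0 ⊎ R (2 + k) ≡ 1 → R (2 + k) ≡ 1
  one nz (inj₁ z) = ⊥-elim (nz z)
  one nz (inj₂ e) = e


-- Setting up and finishing

-- Registers 0, …, k are the last to be filled, including those the program works with: each first
-- receives the address of its final content and is then loaded through itself.
gather : ℕ → Cmd
gather k = block (const 0 0 ∷ add 0 0 2 ∷ put-addresses k) ⨾ block (load-all (suc k))

gather-cost : ℕ → ℕ
gather-cost k = length (const 0 0 ∷ add 0 0 2 ∷ put-addresses k) + length (load-all (suc k))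

record Gathered (R : Memory) (H k : ℕ) (R′ : Memory) : Set where
  field
    low  : ∀ j → j ≤ k → R′ j ≡ R (H + j)
    high : ∀ j → k < j → R′ j ≡ R j

wp-gather : ∀ {R H} k → R 2 ≡ H → k < H → WP R (gather k) (gather-cost k) (Gathered R H k)
wp-gather {R} {H} k e2 k<H = wp-seq (wp-block (wp-block (record
  { low  = λ j j≤k → trans (proj₁ loads j (s≤s j≤k)) (trans (cong R₂ (+-comm j H))
             (untouched (≤-trans k<H (m≤m+n H j))))
  ; high = λ j k<j → trans (proj₂ loads j k<j) (untouched k<j) })))
  where
  R₁ R₂ : Memory
  R₁ = execs (const 0 0 ∷ add 0 0 2 ∷ []) R
  R₂ = execs (put-addresses k) R₁
  addresses : (∀ j → j ≤ k → R₂ j ≡ j + H) × (∀ j → k < j → R₂ j ≡ R₁ j)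
  addresses = exec-put-addresses k e2
  untouched : ∀ {a} → k < a → R₂ a ≡ R a
  untouched {suc a} h = proj₂ addresses (suc a) h
  loads : (∀ j → j < suc k → execs (load-all (suc k)) R₂ j ≡ R₂ (j + H)) ×
          (∀ j → suc k ≤ j → execs (load-all (suc k)) R₂ j ≡ R₂ j)
  loads = exec-load-all (suc k) k<H (λ j h → proj₁ addresses j (s≤s⁻¹ h))

module Frame (d : ℕ) where
  open Programs d

  multiply : Cmd
  multiply = while 3 (block (sub 3 3 0 ∷ add 9 9 1 ∷ []))

  -- The product `m * n` is formed by repeated addition. The matrix is rebuilt at 15 + d + m * n:
  -- first the 13 + d cells in `bs`, then `m * n` words from register 15 + d on. That is more than
  -- the remaining cells, which avoids distinguishing whether the matrix has more than 13 + d cells.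
  setup : List ℕ → Cmd
  setup bs =
    block (const 2 0 ∷ add (12 + d) 0 2 ∷ add (11 + d) 1 2 ∷ add 3 0 2 ∷ const 9 (15 + d) ∷ const 0 1 ∷ []) ⨾
    multiply ⨾
    block (const 5 (15 + d) ∷ sub 3 9 5 ∷ add (13 + d) 9 3 ∷ add 4 5 2 ∷ []) ⨾
    block (put-consts bs) ⨾
    copy

  -- The number of words is stored in the cell H just before the output, so the desired final memory
  -- is the block starting at H, shifted down to 0. Its words from index 15 + d on are copied; the
  -- first 15 + d land on work registers and are left to `gather`.
  finish : Cmd
  finish =
    block (const 0 1 ∷ sub 1 9 (14 + d) ∷ sub 2 (14 + d) 0 ∷ store 2 1 ∷ add 3 1 0 ∷
           const 9 (15 + d) ∷ add 4 2 9 ∷ []) ⨾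
    copy ⨾
    gather (14 + d)

  finish-cost : ℕ → ℕ
  finish-cost L = 7 + ((L + 1) * 7 + 1 + gather-cost (14 + d))

  module Spec {m n : ℕ} (M : Matrix m n) where
    -- Chosen so that `7 + β` is 15 + d + m * n, the first address past the source of the relocating
    -- copy.
    β : ℕ
    β = 8 + d + m * n
    open Testing M β public

    β≥ : 8 + d ≤ β
    β≥ = m≤m+n (8 + d) (m * n)

    p₀ : ℕ
    p₀ = 7 + β + (13 + d) + m * n

    Multiplying : Memory → ℕ → Memory → Set
    Multiplying R k R′ = (R′ 3 ≡ k × R′ 9 + k * n ≡ 15 + d + m * n) ×
      (R′ 0 ≡ 1 × R′ 1 ≡ n × R′ 2 ≡ 0) × SameFrom 10 R R′

    wp-multiply : ∀ {R} → R 0 ≡ 1 → R 1 ≡ n → R 2 ≡ 0 → R 3 ≡ m → R 9 ≡ 15 + d →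
                  WP R multiply (m * 4 + 1) (Multiplying R 0)
    wp-multiply {R} e0 e1 e2 e3 e9 = wp-while (Multiplying R) (λ i → proj₁ (proj₁ i)) (λ i → wp-block (step′ i)) m
      ((e3 , cong (_+ m * n) e9) , (e0 , e1 , e2) , same-refl)
      where
      step′ : ∀ {k R′} → Multiplying R (suc k) R′ → Multiplying R k (execs (sub 3 3 0 ∷ add 9 9 1 ∷ []) R′)
      step′ {k} {R′} ((c , a) , (o , n′ , z) , same) =
        (cong₂ _∸_ c o , trans (cong (λ q → R′ 9 + q + k * n) n′) (trans (+-assoc (R′ 9) n (k * n)) a)) ,
        (o , n′ , z) , sameFrom (same-at same)

    B : ℕ
    B = 15 + d + m * n

    record Globals (R R₁ : Memory) : Set where
      field
        r0   : R₁ 0 ≡ 1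
        r1   : R₁ 1 ≡ n
        r2   : R₁ 2 ≡ 0
        r3   : R₁ 3 ≡ m
        r9   : R₁ 9 ≡ 15 + d
        n₁   : R₁ (11 + d) ≡ n
        m₁   : R₁ (12 + d) ≡ m
        high : ∀ a → R₁ (15 + d + a) ≡ R (15 + d + a)

    globals : ∀ {R} → R 0 ≡ m → R 1 ≡ n → Globals R
      (execs (const 2 0 ∷ add (12 + d) 0 2 ∷ add (11 + d) 1 2 ∷ add 3 0 2 ∷ const 9 (15 + d) ∷ const 0 1 ∷ []) R)
    globals {R} em en = record
      { r0 = refl ; r1 = en ; r2 = refl ; r3 = trans (+-identityʳ _) em ; r9 = refl
      ; n₁ = trans (write-≡ Rₘ (11 + d) _) (trans (+-identityʳ _) en)
      ; m₁ = trans (write-≢ Rₘ {11 + d} {12 + d} _ (>⇒≢ ≤-refl)) (trans (write-≡ (write R 2 0) (12 + d) _) (trans (+-identityʳ _) em))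
      ; high = λ a → trans (write-≢ Rₘ _ (>⇒≢ (≤-trans (m≤n+m _ 3) (m≤m+n (15 + d) a))))
                       (write-≢ (write R 2 0) _ (>⇒≢ (≤-trans (m≤n+m _ 2) (m≤m+n (15 + d) a)))) }
      where
      Rₘ : Memory
      Rₘ = execs (const 2 0 ∷ add (12 + d) 0 2 ∷ []) R

    record Sized (R R₃ : Memory) : Set where
      field
        r0   : R₃ 0 ≡ 1
        r3   : R₃ 3 ≡ m * n
        r4   : R₃ 4 ≡ 15 + d
        r9   : R₃ 9 ≡ B
        end₃ : R₃ (13 + d) ≡ 7 + (β + m * n)
        keep : ∀ a → 10 + a ≢ 13 + d → R₃ (10 + a) ≡ R (10 + a)

    sized : ∀ {R R₂} → Multiplying R 0 R₂ →
            Sized R (execs (const 5 (15 + d) ∷ sub 3 9 5 ∷ add (13 + d) 9 3 ∷ add 4 5 2 ∷ []) R₂)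
    sized {R} {R₂} ((_ , e9) , (e0 , _ , e2) , same) = record
      { r0   = e0
      ; r3   = mn
      ; r4   = trans (cong (15 + d +_) e2) (+-identityʳ _)
      ; r9   = e9′
      ; end₃ = trans (write-≡ Rₛ (13 + d) _) (cong₂ _+_ e9′ mn)
      ; keep = λ a ne → trans (write-≢ Rₛ _ ne) (same-at same a) }
      where
      Rₛ : Memory
      Rₛ = execs (const 5 (15 + d) ∷ sub 3 9 5 ∷ []) R₂
      e9′ : R₂ 9 ≡ B
      e9′ = trans (sym (+-identityʳ _)) e9
      mn : R₂ 9 ∸ (15 + d) ≡ m * n
      mn = trans (cong (_∸ (15 + d)) e9′) (m+n∸m≡n (15 + d) (m * n))

    relocated : ∀ {R R₁ R₃ R₄ R₅ bs} → Globals R R₁ → Sized R₁ R₃ → PutConsts R₃ B bs R₄ →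
                Copied R₄ (15 + d) (B + (13 + d)) (m * n) R₅ →
                (∀ i j → R (2 + (toℕ i * n + toℕ j)) ≡ bit (M i j)) → length bs ≡ 13 + d → Seg R 2 bs → Env R₅
    relocated {R} {R₁} {R₃} {R₄} {R₅} {bs} g z put c cells len seg = record
      { n-reg   = trans (low₅ 1 (m≤m+n 2 3)) (trans (Sized.keep z (1 + d) (<⇒≢ (n≤1+n _))) (Globals.n₁ g))
      ; m-reg   = trans (low₅ 2 (m≤m+n 3 2)) (trans (Sized.keep z (2 + d) (<⇒≢ ≤-refl)) (Globals.m₁ g))
      ; end-reg = trans (low₅ 3 (m≤m+n 4 1)) (Sized.end₃ z)
      ; cell    = λ i j → trans (cong R₅ (+-assoc B (toℕ i * n) (toℕ j)))
                    (trans (moved (toℕ i * n + toℕ j) (index< i j)) (cells i j)) }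
      where
      low₅ : ∀ k → k < 5 → R₅ (10 + (k + d)) ≡ R₃ (10 + (k + d))
      low₅ k k<5 = trans (Copied.other c _ (m≤m+n 10 _) (inj₁ (≤-trans a<B (m≤m+n B (13 + d)))))
                         (PutConsts.below put _ a<B (λ ()) (λ ()))
        where
        a<B : 10 + (k + d) < B
        a<B = ≤-trans (+-monoʳ-≤ 10 (+-monoˡ-≤ d k<5)) (m≤m+n (15 + d) _)
      index< : ∀ i j → toℕ {m} i * n + toℕ {n} j < m * n
      index< i j = ≤-trans (+-monoʳ-< (toℕ i * n) (Fin.toℕ<n j))
        (≤-trans (≤-reflexive (+-comm (toℕ i * n) n)) (*-monoˡ-≤ n (Fin.toℕ<n i)))
      moved : ∀ t → t < m * n → R₅ (B + t) ≡ R (2 + t)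
      -- Cells before index 13 + d come back from the bits in the control flow, later ones from the
      -- copy.
      moved t t< = split (t <? 13 + d)
        where
        u : ℕ
        u = t ∸ (13 + d)
        u< : u < m * n
        u< = ≤-<-trans (m∸n≤m t (13 + d)) t<
        split : Dec (t < 13 + d) → R₅ (B + t) ≡ R (2 + t)
        split (yes h) = trans (Copied.other c (B + t) (m≤m+n 10 _) (inj₁ (+-monoʳ-< B h)))
                          (seg-lookup (PutConsts.seg put) seg t (subst (t <_) (sym len) h))
        split (no ¬h) =
          trans (cong (λ q → R₅ (B + q)) (sym eq))
          (trans (cong R₅ (sym (+-assoc B (13 + d) u)))
          (trans (Copied.copied c u u<)
          (trans (PutConsts.below put (15 + d + u) (+-monoʳ-< (15 + d) u<) (λ ()) (λ ()))
          (trans (Sized.keep z (5 + (d + u)) (>⇒≢ (≤-trans (n≤1+n (14 + d)) (m≤m+n (15 + d) u))))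
          (trans (Globals.high g u) (cong (λ q → R (2 + q)) eq))))))
          where
          eq : 13 + d + u ≡ t
          eq = m+[n∸m]≡n (≮⇒≥ ¬h)

    setup-cost : ℕ → ℕ
    setup-cost k = 6 + (m * 4 + 1 + (4 + (k * 3 + (m * n * 7 + 1))))

    wp-setup : ∀ {R} bs → R 0 ≡ m → R 1 ≡ n → (∀ i j → R (2 + (toℕ i * n + toℕ j)) ≡ bit (M i j)) →
               length bs ≡ 13 + d → Seg R 2 bs → WP R (setup bs) (setup-cost (13 + d)) (λ R′ → Env R′ × R′ 9 ≡ p₀)
    wp-setup {R} bs em en cells len seg =
      wp-seq (wp-mono ≤-refl after-globals (wp-block (globals em en)))
      where
      Post : Memory → Set
      Post R′ = Env R′ × R′ 9 ≡ p₀
      after-put : ∀ {R₁ R₃} → Globals R R₁ → Sized R₁ R₃ → ∀ R₄ → PutConsts R₃ B bs R₄ → WP R₄ copy (m * n * 7 + 1) Post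
      after-put g z R₄ put = wp-mono ≤-refl (λ R₅ c → relocated g z put c cells len seg , Copied.ptr c)
        (wp-copy (m * n)
          (trans (low₄ 0 (s≤s z≤n) (λ ()) (λ ())) (Sized.r0 z))
          (trans (low₄ 3 (m≤m+n 4 _) (λ ()) (λ ())) (Sized.r3 z))
          (trans (low₄ 4 (m≤m+n 5 _) (λ ()) (λ ())) (Sized.r4 z))
          (trans (PutConsts.ptr put) (cong (B +_) len))
          (m≤m+n 10 _) (m≤m+n 10 _) (inj₁ (m≤m+n B (13 + d))))
        where
        low₄ : ∀ a → a < B → a ≢ 6 → a ≢ 9 → _
        low₄ = PutConsts.below put
      after-sized : ∀ {R₁} → Globals R R₁ → ∀ R₃ → Sized R₁ R₃ →
                    WP R₃ (block (put-consts bs) ⨾ copy) ((13 + d) * 3 + (m * n * 7 + 1)) Post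
      after-sized g R₃ z = wp-seq (wp-mono (≤-reflexive (trans (length-put-consts bs) (cong (_* 3) len)))
        (after-put g z) (wp-block (exec-put-consts bs (Sized.r0 z) (Sized.r9 z) (m≤m+n 10 _))))
      after-globals : ∀ R₁ → Globals R R₁ →
                      WP R₁ (multiply ⨾ block (const 5 (15 + d) ∷ sub 3 9 5 ∷ add (13 + d) 9 3 ∷ add 4 5 2 ∷ []) ⨾
                             block (put-consts bs) ⨾ copy)
                        (m * 4 + 1 + (4 + ((13 + d) * 3 + (m * n * 7 + 1)))) Post
      after-globals R₁ g = wp-seq (wp-mono ≤-refl (λ R₂ i → wp-seq (wp-mono ≤-refl (after-sized g) (wp-block (sized i))))
        (wp-multiply (Globals.r0 g) (Globals.r1 g) (Globals.r2 g) (Globals.r3 g) (Globals.r9 g)))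

  -- The last inequality keeps the target of the downward copy below `H`, from where `gather` still
  -- has to read.
  wp-finish : ∀ {R H ws} → R (14 + d) ≡ suc H → R 9 ≡ suc H + length ws → Seg R (suc H) ws → 15 + d + (length ws + 1) ≤ H →
              WP R finish (finish-cost (length ws)) (λ R′ → output R′ ≡ ws)
  wp-finish {R} {H} {ws} eH e9 seg H≥ =
    wp-seq (wp-block (wp-seq (wp-mono ≤-refl stage₂
      (wp-copy (L + 1) (trans (low₁ 0 (s≤s z≤n)) refl) counter₁ source₁ refl (≤-trans (m≤m+n 10 (5 + d)) (m≤n+m _ H)) (m≤m+n 10 _) (inj₂ (m≤n+m _ H))))))
    where
    L : ℕ
    L = length ws
    15≤H : 15 + d ≤ H
    15≤H = ≤-trans (m≤m+n (15 + d) _) H≥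
    Rₐ Rᵦ R₁ : Memory
    Rₐ = execs (const 0 1 ∷ sub 1 9 (14 + d) ∷ sub 2 (14 + d) 0 ∷ []) R
    Rᵦ = execs (store 2 1 ∷ []) Rₐ
    R₁ = execs (add 3 1 0 ∷ const 9 (15 + d) ∷ add 4 2 9 ∷ []) Rᵦ
    eL : Rₐ 1 ≡ L
    eL = trans (cong₂ _∸_ e9 eH) (m+n∸m≡n (suc H) L)
    eS : Rₐ 2 ≡ H
    eS = cong (_∸ 1) eH
    lowᵦ : ∀ a → a < 15 + d → Rᵦ a ≡ Rₐ a
    lowᵦ a h = write-≢ Rₐ _ (λ e → <⇒≢ (<-≤-trans h 15≤H) (trans e eS))
    low₁ : ∀ a → a < 1 → R₁ a ≡ 1
    low₁ zero _ = lowᵦ 0 (s≤s z≤n)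
    low₁ (suc a) (s≤s ())
    counter₁ : R₁ 3 ≡ L + 1
    counter₁ = cong₂ _+_ (trans (lowᵦ 1 (s≤s (s≤s z≤n))) eL) (lowᵦ 0 (s≤s z≤n))
    e2 : Rᵦ 2 ≡ H
    e2 = trans (lowᵦ 2 (m≤m+n 3 _)) eS
    source₁ : R₁ 4 ≡ H + (15 + d)
    source₁ = cong (_+ (15 + d)) e2
    high₁ : ∀ {a} → 10 ≤ a → R₁ a ≡ Rᵦ a
    high₁ h = subst (λ q → R₁ q ≡ Rᵦ q) (m+[n∸m]≡n h) refl
    10≤H : 10 ≤ H
    10≤H = ≤-trans (m≤m+n 10 _) 15≤H
    seg-listMem : ∀ {R p ws} → Seg R p ws → ∀ j → j < length ws → R (p + j) ≡ listMem ws j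
    seg-listMem {R} {p} (e ∷ s) zero    h       = trans (cong R (+-identityʳ p)) e
    seg-listMem {R} {p} (e ∷ s) (suc j) (s≤s h) = trans (cong R (+-suc p j)) (seg-listMem s j h)
    cell₁ : ∀ j → j ≤ L → R₁ (H + j) ≡ listMem (L ∷ ws) j
    cell₁ zero    h = trans (cong R₁ (+-identityʳ H)) (trans (high₁ 10≤H)
      (trans (cong (λ q → write Rₐ q (Rₐ 1) H) eS) (trans (write-≡ Rₐ H _) eL)))
    cell₁ (suc j) h = trans (high₁ (≤-trans 10≤H (m≤m+n H _)))
      (trans (write-≢ Rₐ _ (λ e → >⇒≢ (m<m+n H {suc j} (s≤s z≤n)) (trans e eS)))
        (trans (Rₐ-high (≤-trans 10≤H (m≤m+n H _))) (trans (cong R (+-suc H j)) (seg-listMem seg j h))))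
      where
      Rₐ-high : ∀ {a} → 10 ≤ a → Rₐ a ≡ R a
      Rₐ-high h = subst (λ q → Rₐ q ≡ R q) (m+[n∸m]≡n h) refl
    gathered : ∀ {R₂ R₄} → Copied R₁ (H + (15 + d)) (15 + d) (L + 1) R₂ → Gathered R₂ H (14 + d) R₄ →
               output R₄ ≡ ws
    gathered {R₂} {R₄} c g = trans (map-upTo (λ i → R₄ (suc i)) (R₄ 0))
      (trans (cong (applyUpTo (λ i → R₄ (suc i))) (trans (final 0 z≤n) (cell₁ 0 z≤n))) (seg-output seg₄))
      where
      final : ∀ j → j ≤ L → R₄ j ≡ R₁ (H + j)
      final j h = split (j <? 15 + d)
        where
        split : Dec (j < 15 + d) → R₄ j ≡ R₁ (H + j)
        split (yes low) = trans (Gathered.low g j (s≤s⁻¹ low))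
          (Copied.other c (H + j) (≤-trans 10≤H (m≤m+n H j)) (inj₂ (≤-trans H≥ (m≤m+n H j))))
        split (no ¬low) = trans (Gathered.high g j (≮⇒≥ ¬low)) (trans (cong R₂ (sym eq))
          (trans (Copied.copied c u (≤-trans (s≤s (≤-trans (m∸n≤m j (15 + d)) h)) (≤-reflexive (+-comm 1 L))))
            (cong R₁ (trans (+-assoc H (15 + d) u) (cong (H +_) eq)))))
          where
          u : ℕ
          u = j ∸ (15 + d)
          eq : 15 + d + u ≡ j
          eq = m+[n∸m]≡n (≮⇒≥ ¬low)
      seg₄ : Seg R₄ 1 ws
      seg₄ = seg-map seg (λ i h → trans (final (suc i) h) (trans (cell₁ (suc i) h) (sym (seg-listMem seg i h))))
    stage₂ : ∀ R₂ → Copied R₁ (H + (15 + d)) (15 + d) (L + 1) R₂ →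
             WP R₂ (gather (14 + d)) (gather-cost (14 + d)) (λ R′ → output R′ ≡ ws)
    stage₂ R₂ c = wp-mono ≤-refl (λ R₄ → gathered c) (wp-gather (14 + d) (trans (Copied.r2 c) e2) 15≤H)


-- The enumerated lists and the running time

module EnumerationProperties {n : ℕ} where
  open Enumeration {n}

  -- Reverse-append fits because `W` lists the added columns in the order in which the loops choose
  -- them, each going in front of the previous one.
  enum-extends : ∀ f {b} (b≤n : b ≤ n) {X Z} → Z ∈ enum f b≤n X → ∃[ W ] Z ≡ W ʳ++ X
  enumBelow-extends : ∀ f b (b≤n : b ≤ n) {X Z} → Z ∈ enumBelow f b b≤n X →
                      ∃[ W ] ∃[ w ] (toℕ w < b × Z ≡ W ʳ++ (w ∷ X))
  enum-extends zero    b≤n (here refl) = [] , refl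
  enum-extends (suc f) b≤n (here refl) = [] , refl
  enum-extends (suc f) b≤n (there p) with enumBelow-extends f _ b≤n p
  ... | W , w , _ , eq = w ∷ W , eq
  enumBelow-extends f (suc b) b<n {X} p with ∈-++⁻ (enum f (<⇒≤ b<n) (fromℕ< b<n ∷ X)) p
  ... | inj₁ q with enum-extends f (<⇒≤ b<n) q
  ...   | W , eq = W , fromℕ< b<n , s≤s (≤-reflexive (Fin.toℕ-fromℕ< b<n)) , eq
  enumBelow-extends f (suc b) b<n {X} p | inj₂ q with enumBelow-extends f b (<⇒≤ b<n) q
  ...   | W , w , w<b , eq = W , w , m≤n⇒m≤1+n w<b , eq

  ʳ++-cancel : ∀ (W W′ : List (Fin n)) {Y Y′} → length Y ≡ length Y′ → W ʳ++ Y ≡ W′ ʳ++ Y′ → Y ≡ Y′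
  ʳ++-cancel []      []        len eq = eq
  ʳ++-cancel []      (w ∷ W′) {Y} {Y′} len eq = ⊥-elim (<⇒≢ (m≤n+m (suc (length Y′)) (length W′))
    (trans (sym len) (trans (cong length eq) (length-ʳ++ W′))))
  ʳ++-cancel (w ∷ W) []       {Y} {Y′} len eq = ⊥-elim (<⇒≢ (m≤n+m (suc (length Y)) (length W))
    (trans len (trans (cong length (sym eq)) (length-ʳ++ W))))
  ʳ++-cancel (w ∷ W) (w′ ∷ W′) len eq = ∷-injectiveʳ (ʳ++-cancel W W′ (cong suc len) eq)

  -- Proper extensions are longer than `X`, and extensions from different iterations differ in the
  -- column placed directly in front of `X`.
  enum-unique : ∀ f {b} (b≤n : b ≤ n) X → Unique (enum f b≤n X)
  enumBelow-unique : ∀ f b (b≤n : b ≤ n) X → Unique (enumBelow f b b≤n X)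
  enum-unique zero    b≤n X = [] ∷ []
  enum-unique (suc f) {b} b≤n X = All.tabulate distinct ∷ enumBelow-unique f b b≤n X
    where
    distinct : ∀ {Z} → Z ∈ enumBelow f b b≤n X → X ≢ Z
    distinct p refl with enumBelow-extends f b b≤n p
    ... | W , w , _ , eq = <⇒≢ (m≤n+m (suc (length X)) (length W)) (trans (cong length eq) (length-ʳ++ W))
  enumBelow-unique f zero    b≤n X = []
  enumBelow-unique f (suc b) b<n X =
    Unique.++⁺ (enum-unique f (<⇒≤ b<n) (fromℕ< b<n ∷ X)) (enumBelow-unique f b (<⇒≤ b<n) X) disjoint
    where
    disjoint : ∀ {Z} → ¬ (Z ∈ enum f (<⇒≤ b<n) (fromℕ< b<n ∷ X) × Z ∈ enumBelow f b (<⇒≤ b<n) X)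
    disjoint (p , q) with enum-extends f (<⇒≤ b<n) p | enumBelow-extends f b (<⇒≤ b<n) q
    ... | W , eq | W′ , w , w<b , eq′ with ∷-injectiveˡ (ʳ++-cancel W W′ refl (trans (sym eq) eq′))
    ...   | refl = <-irrefl (Fin.toℕ-fromℕ< b<n) w<b

  enum-sorted : ∀ f {b} (b≤n : b ≤ n) {X} → StrictSorted X → All (λ x → b ≤ toℕ x) X → All StrictSorted (enum f b≤n X)
  enumBelow-sorted : ∀ f b (b≤n : b ≤ n) {X} → StrictSorted X → All (λ x → b ≤ toℕ x) X →
                     All StrictSorted (enumBelow f b b≤n X)
  enum-sorted zero    b≤n s bs = s ∷ []
  enum-sorted (suc f) b≤n s bs = s ∷ enumBelow-sorted f _ b≤n s bs
  enumBelow-sorted f zero    b≤n s bs = []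
  enumBelow-sorted f (suc b) b<n {X} s bs =
    All.++⁺ (enum-sorted f (<⇒≤ b<n) (link s bs) (≤-reflexive (sym (Fin.toℕ-fromℕ< b<n)) ∷ All.map <⇒≤ bs))
            (enumBelow-sorted f b (<⇒≤ b<n) s (All.map <⇒≤ bs))
    where
    link : ∀ {X} → StrictSorted X → All (λ x → b < toℕ x) X → StrictSorted (fromℕ< b<n ∷ X)
    link []        []      = [-]
    link [-]       (l ∷ _) = subst (_< _) (sym (Fin.toℕ-fromℕ< b<n)) l ∷ [-]
    link (l′ ∷ s) (l ∷ _) = subst (_< _) (sym (Fin.toℕ-fromℕ< b<n)) l ∷ l′ ∷ s

  -- The loop bound in force at a list: its smallest column so far, or n before any choice.
  top : List (Fin n) → ℕ
  top []      = n
  top (x ∷ _) = toℕ x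

  sorted-suffix : ∀ W {Y : List (Fin n)} → StrictSorted (W ʳ++ Y) → StrictSorted Y
  sorted-suffix []      s = s
  sorted-suffix (w ∷ W) s = Linked.tail (sorted-suffix W s)

  head<top : ∀ {w X} → StrictSorted (w ∷ X) → toℕ w < top X
  head<top {w} {[]}    s       = Fin.toℕ<n w
  head<top {w} {_ ∷ _} (l ∷ _) = l

  ∈-enumBelow : ∀ f b (b≤n : b ≤ n) {w X Z} → toℕ w < b →
                (∀ {b′} (b′≤n : b′ ≤ n) → toℕ w ≡ b′ → Z ∈ enum f b′≤n (w ∷ X)) → Z ∈ enumBelow f b b≤n X
  ∈-enumBelow f (suc b) b<n {w} {X} {Z} w< p with toℕ w ≟ b
  ... | yes eq = ∈-++⁺ˡ (subst (λ v → Z ∈ enum f (<⇒≤ b<n) (v ∷ X))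
                   (Fin.toℕ-injective (trans eq (sym (Fin.toℕ-fromℕ< b<n)))) (p (<⇒≤ b<n) eq))
  ... | no ne  = ∈-++⁺ʳ _ (∈-enumBelow f b (<⇒≤ b<n) (≤∧≢⇒< (s≤s⁻¹ w<) ne) p)

  ∈-enum : ∀ W {f b X} (b≤n : b ≤ n) → top X ≡ b → length W ≤ f → StrictSorted (W ʳ++ X) → W ʳ++ X ∈ enum f b≤n X
  ∈-enum []      {zero}  b≤n eq len s = here refl
  ∈-enum []      {suc f} b≤n eq len s = here refl
  ∈-enum (w ∷ W) {suc f} {b} {X} b≤n eq (s≤s len) s =
    there (∈-enumBelow f b b≤n (subst (toℕ w <_) eq (head<top (sorted-suffix W s)))
      (λ b′≤n eq′ → ∈-enum W b′≤n eq′ len s))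

module FaceLists {m n : ℕ} (M : Matrix m n) where
  open Independence M
  open Enumeration {n}
  open EnumerationProperties {n}

  faces : ℕ → List (List (Fin n))
  faces k = filter (λ X → ind? (length X) X) (enum k ≤-refl [])

  marked : ℕ → List (List (Fin n) × Bool)
  marked k = map (λ X → X , does (maximal? X)) (faces k)

  faces-sound : ∀ k {X} → X ∈ faces k → Face M X
  faces-sound k p with ∈-filter⁻ (λ X → ind? (length X) X) {xs = enum k ≤-refl []} p
  ... | q , i = All.lookup (enum-sorted k ≤-refl [] []) q , Independent⇒Indep (Ind⇒Independent _ _ refl i)

  faces-isFaceList : ∀ {d} → HasDim M d → IsFaceList M (faces (suc d))
  faces-isFaceList {d} (_ , dim) =
    All.tabulate (λ p → proj₁ (faces-sound (suc d) p)) ,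
    Unique.filter⁺ (λ X → ind? (length X) X) (enum-unique (suc d) ≤-refl []) ,
    λ X → faces-sound (suc d) , λ face →
      ∈-filter⁺ (λ X → ind? (length X) X)
        -- The loops choose the columns of a sorted face from the largest down, so its order of
        -- choice is the reversed list.
        (subst (_∈ enum (suc d) ≤-refl []) (reverse-involutive X)
          (∈-enum (reverse X) ≤-refl refl (subst (_≤ suc d) (sym (length-reverse X)) (dim X face))
            (subst StrictSorted (sym (reverse-involutive X)) (proj₁ face))))
        (Independent⇒Ind _ _ refl (Indep⇒Independent (proj₂ face)))

  marked-isMarkedFaceList : ∀ {d} → HasDim M d → IsMarkedFaceList M (marked (suc d))
  marked-isMarkedFaceList {d} dim = subst (IsFaceList M) (sym (proj₁-marked (faces (suc d)))) (faces-isFaceList dim) ,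
    All.map⁺ (All.tabulate (λ {X} p → marks X (faces-sound (suc d) p)))
    where
    proj₁-marked : ∀ fs → map proj₁ (map (λ X → X , does (maximal? X)) fs) ≡ fs
    proj₁-marked []       = refl
    proj₁-marked (X ∷ fs) = cong (X ∷_) (proj₁-marked fs)
    marks : ∀ X → Face M X → (does (maximal? X) ≡ true → Facet M X) × (Facet M X → does (maximal? X) ≡ true)
    marks X face = (λ eq → Maximal⇒Facet face (proof (maximal? X) eq)) , λ facet → dec-true (maximal? X) (Facet⇒Maximal facet)
      where
      proof : ∀ {P : Set} (P? : Dec P) → does P? ≡ true → P
      proof (yes p) _ = p

  encode-faces : ∀ Xs → concatMap faceWords Xs ≡ encodeFaces (filter (λ X → ind? (length X) X) Xs)
  encode-faces []       = refl
  encode-faces (X ∷ Xs) with does (ind? (length X) X)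
  ... | true  = cong (encodeFace X ++_) (encode-faces Xs)
  ... | false = encode-faces Xs

  encode-marked : ∀ Xs → concatMap markedWords Xs ≡
    encodeMarked (map (λ X → X , does (maximal? X)) (filter (λ X → ind? (length X) X) Xs))
  encode-marked []       = refl
  encode-marked (X ∷ Xs) with does (ind? (length X) X)
  ... | true  = cong ((bit (does (maximal? X)) ∷ encodeFace X) ++_) (encode-marked Xs)
  ... | false = encode-marked Xs

-- Since n + 1 is at most 2n, the base n + 1 of the row count is traded for n at the price of a
-- constant.
^-doubles : ∀ {n} d → 1 ≤ n → suc n ^ d ≤ 2 ^ d * n ^ d
^-doubles zero 1≤n = ≤-refl
^-doubles {n} (suc d) 1≤n = begin
  suc n * suc n ^ d             ≤⟨ *-mono-≤ (+-monoˡ-≤ n 1≤n) (^-doubles d 1≤n) ⟩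
  (n + n) * (2 ^ d * n ^ d)     ≡⟨ cong (λ q → (n + q) * (2 ^ d * n ^ d)) (sym (+-identityʳ n)) ⟩
  2 * n * (2 ^ d * n ^ d)       ≡⟨ [m*n]*[o*p]≡[m*o]*[n*p] 2 n (2 ^ d) (n ^ d) ⟩
  2 ^ suc d * n ^ suc d         ∎
  where open ≤-Reasoning

-- The complete program and its running time

module Main (d : ℕ) (emit : List ℕ → Cmd) (cost : List ℕ → ℕ) where
  open Visits d emit cost using (visit; visit-cost)
  open Frame d

  -- The first visit only measures the output; the second writes it again, high enough not to overlap
  -- its final position.
  leaf : List ℕ → Cmd
  leaf bs = setup bs ⨾ visit (suc d) [] ⨾ block (const 0 0 ∷ add (14 + d) 9 0 ∷ []) ⨾ visit (suc d) [] ⨾ finish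

  main : Cmd
  main = readBits leaf (13 + d) []

  -- Each factor mirrors the corresponding cost term by term, with m, `m * n` and the output length
  -- replaced by their coefficients relative to `N`.
  vc setup-factor finish-factor rest-factor factor : ℕ
  vc = visit-cost (suc d) []
  setup-factor = 6 + (4 + 1 + (4 + ((13 + d) * 3 + (7 + 1))))
  finish-tail : ℕ
  finish-tail = gather-cost (14 + d)
  finish-factor = 7 + (7 * (vc + 1) + 1 + finish-tail)
  rest-factor = vc + (2 + (vc + finish-factor))
  factor = (13 + d) * 2 + (setup-factor + rest-factor)

  module _ {m n : ℕ} (M : Matrix m n) (1≤n : 1 ≤ n) where
    open Frame.Spec d M
    open Visits.Spec d emit cost M β β≥ 1≤n using (EmitSpec; env-keeps; wp-visit; words-length)
    open Enumeration {n} using (words)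

    module _ (σ : ℕ) (m<σ : suc m ≤ σ) (W : List (Fin n) → List ℕ) (wp-emit : EmitSpec σ W)
             (W≤ : ∀ ls X → length ls ≡ length X → length (W X) ≤ cost ls * σ) where

      1≤σ : 1 ≤ σ
      1≤σ = ≤-trans (s≤s z≤n) m<σ

      ws : List ℕ
      ws = words W (suc d) ≤-refl []

      L N : ℕ
      L = length ws
      N = n ^ suc d * σ

      L≤ : L ≤ vc * N
      L≤ = words-length σ 1≤σ W wp-emit W≤ (suc d) ≤-refl [] [] refl

      wp-leaf : ∀ {R} bs → R 0 ≡ m → R 1 ≡ n → (∀ i j → R (2 + (toℕ i * n + toℕ j)) ≡ bit (M i j)) →
                length bs ≡ 13 + d → Seg R 2 bs →
                WP R (leaf bs) (setup-cost (13 + d) + (vc * N + (2 + (vc * N + finish-cost L)))) (λ R′ → output R′ ≡ ws)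
      wp-leaf bs em en cells len bits = wp-seq (wp-mono ≤-refl first (wp-setup bs em en cells len bits))
        where
        end≤p₀ : 7 + (β + m * n) ≤ p₀
        end≤p₀ = +-monoˡ-≤ (m * n) (m≤m+n (7 + β) (13 + d))
        first : ∀ R₁ → Env R₁ × R₁ 9 ≡ p₀ →
                WP R₁ (visit (suc d) [] ⨾ block (const 0 0 ∷ add (14 + d) 9 0 ∷ []) ⨾ visit (suc d) [] ⨾ finish)
                  (vc * N + (2 + (vc * N + finish-cost L))) (λ R′ → output R′ ≡ ws)
        first R₁ (env₁ , e9) = wp-seq (wp-mono ≤-refl second
          (wp-visit σ 1≤σ W wp-emit (suc d) ≤-refl ≤-refl env₁ end≤p₀ e9 (n-reg env₁) []))
          where
          second : ∀ R₂ → Emitted (11 + d) R₁ p₀ ws R₂ →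
                   WP R₂ (block (const 0 0 ∷ add (14 + d) 9 0 ∷ []) ⨾ visit (suc d) [] ⨾ finish)
                     (2 + (vc * N + finish-cost L)) (λ R′ → output R′ ≡ ws)
          second R₂ e = wp-seq (wp-block (wp-seq (wp-mono ≤-refl third
              (wp-visit σ 1≤σ W wp-emit (suc d) ≤-refl ≤-refl env₃ end≤p₁ (ptr e) (n-reg env₃) []))))
            where
            p₁ H : ℕ
            p₁ = p₀ + L
            H = 6 + β + (13 + d) + m * n + L
            end≤p₁ : 7 + (β + m * n) ≤ p₁
            end≤p₁ = ≤-trans end≤p₀ (m≤m+n p₀ L)
            R₃ : Memory
            R₃ = execs (const 0 0 ∷ add (14 + d) 9 0 ∷ []) R₂
            env₂ : Env R₂
            env₂ = env-keeps ≤-refl end≤p₀ (below e) env₁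
            save-≢ : ∀ {a} → 1 + a ≢ 14 + d → R₃ (1 + a) ≡ R₂ (1 + a)
            save-≢ = write-≢ (write R₂ 0 0) _
            env₃ : Env R₃
            env₃ = record
              { n-reg   = trans (save-≢ (<⇒≢ (m≤n+m (12 + d) 2))) (n-reg env₂)
              ; m-reg   = trans (save-≢ (<⇒≢ (m≤n+m (13 + d) 1))) (m-reg env₂)
              ; end-reg = trans (save-≢ (<⇒≢ ≤-refl)) (end-reg env₂)
              ; cell    = λ i j → trans (save-≢ (>⇒≢ (+-monoʳ-≤ 7 (≤-trans β≥
                            (≤-trans (m≤m+n β _) (m≤m+n _ (toℕ j))))))) (cell env₂ i j) }
            saved : R₃ (14 + d) ≡ p₁
            saved = trans (write-≡ (write R₂ 0 0) (14 + d) _) (trans (+-identityʳ _) (ptr e))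
            H≥ : 15 + d + (L + 1) ≤ H
            H≥ = ≤-trans (≤-reflexive (trans (cong (15 + d +_) (+-comm L 1)) (+-suc (15 + d) L)))
              (+-monoˡ-≤ L (≤-trans (+-monoˡ-≤ (13 + d) (m≤m+n 3 (3 + β))) (m≤m+n _ (m * n))))
            third : ∀ R₄ → Emitted (11 + d) R₃ p₁ ws R₄ → WP R₄ finish (finish-cost L) (λ R′ → output R′ ≡ ws)
            third R₄ e′ = wp-finish {H = H} (trans (kept (below e′) (14 + d) (m≤n+m (11 + d) 3) 14+d<p₁) saved)
              (ptr e′) (seg e′) H≥
              where
              14+d<p₁ : 14 + d < p₁
              14+d<p₁ = ≤-trans (≤-trans (m≤m+n (15 + d) (L + 1)) H≥) (n≤1+n H)

      cost≤ : (13 + d) * 2 + (setup-cost (13 + d) + (vc * N + (2 + (vc * N + finish-cost L)))) ≤ factor * N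
      cost≤ = +-scaled ((13 + d) * 2) (setup-factor + rest-factor) N (≤-scaled _ 1≤N)
        (+-scaled setup-factor rest-factor N setup≤
        (+-scaled vc (2 + (vc + finish-factor)) N ≤-refl
        (+-scaled 2 (vc + finish-factor) N (≤-scaled 2 1≤N)
        (+-scaled vc finish-factor N ≤-refl finish≤))))
        where
        instance
          n≢0 : NonZero n
          n≢0 = >-nonZero 1≤n
        1≤nᵈ : 1 ≤ n ^ d
        1≤nᵈ = m^n>0 n d
        σ≤N : σ ≤ N
        σ≤N = m≤n*m σ (n ^ suc d) {{>-nonZero (m^n>0 n (suc d))}}
        1≤N : 1 ≤ N
        1≤N = ≤-trans 1≤σ σ≤N
        m≤σ : m ≤ σ
        m≤σ = <⇒≤ m<σ
        mn≤N : m * n ≤ N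
        mn≤N = ≤-trans (≤-reflexive (*-comm m n)) (*-mono-≤ (m≤m*n n (n ^ d) {{>-nonZero 1≤nᵈ}}) m≤σ)
        k : ℕ
        k = (13 + d) * 3
        setup≤ : setup-cost (13 + d) ≤ setup-factor * N
        setup≤ = +-scaled 6 (4 + 1 + (4 + (k + (7 + 1)))) N (≤-scaled 6 1≤N)
          (+-scaled (4 + 1) (4 + (k + (7 + 1))) N
            (+-scaled 4 1 N (≤-trans (≤-reflexive (*-comm m 4)) (*-monoʳ-≤ 4 (≤-trans m≤σ σ≤N))) (≤-scaled 1 1≤N))
          (+-scaled 4 (k + (7 + 1)) N (≤-scaled 4 1≤N) (+-scaled k (7 + 1) N (≤-scaled k 1≤N)
            (+-scaled 7 1 N (≤-trans (≤-reflexive (*-comm (m * n) 7)) (*-monoʳ-≤ 7 mn≤N)) (≤-scaled 1 1≤N)))))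
        finish≤ : finish-cost L ≤ finish-factor * N
        finish≤ = +-scaled 7 (7 * (vc + 1) + 1 + finish-tail) N (≤-scaled 7 1≤N)
          (+-scaled (7 * (vc + 1) + 1) finish-tail N
            (+-scaled (7 * (vc + 1)) 1 N
              (≤-trans (≤-reflexive (*-comm (L + 1) 7))
                (≤-trans (*-monoʳ-≤ 7 (+-scaled vc 1 N L≤ (≤-scaled 1 1≤N))) (≤-reflexive (sym (*-assoc 7 (vc + 1) N)))))
              (≤-scaled 1 1≤N))
            (≤-scaled finish-tail 1≤N))

      wp-main : WP (listMem (encodeMatrix M)) main
        ((13 + d) * 2 + (setup-cost (13 + d) + (vc * N + (2 + (vc * N + finish-cost L))))) (λ R → output R ≡ ws)
      wp-main = wp-readBits {leaf = leaf} (13 + d) [] (bits-matrix M) []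
        (λ bs len → wp-leaf bs refl refl (listMem-matrix (λ i j → bit (M i j))) (trans len (+-identityʳ (13 + d))))

      run-main : ∃[ t ] ∃[ s ] (t ≤ factor * N × run (compile main 0) t (initState M) ≡ just s ×
                                output (State.mem s) ≡ ws)
      run-main = wp-run {c = main} (wp-mono cost≤ (λ _ → id) wp-main)

-- The row bound gives at most `2 ^ d * n ^ d` rows; the successor in `suc (2 ^ d)` absorbs the one
-- in `suc m`. With the d + 1 loops the exponent becomes (d + 1) + d.
size≤ : ∀ {m n} d u (M : Matrix m n) → 1 ≤ n → Reduced M → HasDim M d →
        n ^ suc d * (suc m * u) ≤ suc (2 ^ d) * (n ^ (2 * d + 1) * u)
size≤ {m} {n} d u M 1≤n red dim = begin
  n ^ suc d * (suc m * u)                       ≤⟨ *-monoʳ-≤ (n ^ suc d) (*-monoˡ-≤ u rows) ⟩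
  n ^ suc d * (suc (2 ^ d) * n ^ d * u)         ≡⟨ cong (n ^ suc d *_) (*-assoc (suc (2 ^ d)) (n ^ d) u) ⟩
  n ^ suc d * (suc (2 ^ d) * (n ^ d * u))       ≡⟨ sym (*-assoc (n ^ suc d) (suc (2 ^ d)) _) ⟩
  n ^ suc d * suc (2 ^ d) * (n ^ d * u)         ≡⟨ cong (_* (n ^ d * u)) (*-comm (n ^ suc d) (suc (2 ^ d))) ⟩
  suc (2 ^ d) * n ^ suc d * (n ^ d * u)         ≡⟨ *-assoc (suc (2 ^ d)) (n ^ suc d) _ ⟩
  suc (2 ^ d) * (n ^ suc d * (n ^ d * u))       ≡⟨ cong (suc (2 ^ d) *_) (sym (*-assoc (n ^ suc d) (n ^ d) u)) ⟩
  suc (2 ^ d) * (n ^ suc d * n ^ d * u)         ≡⟨ cong (λ q → suc (2 ^ d) * (q * u)) (sym (^-distribˡ-+-* n (suc d) d)) ⟩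
  suc (2 ^ d) * (n ^ (suc d + d) * u)           ≡⟨ cong (λ q → suc (2 ^ d) * (n ^ q * u)) exponent ⟩
  suc (2 ^ d) * (n ^ (2 * d + 1) * u)           ∎
  where
  open ≤-Reasoning
  rows : suc m ≤ suc (2 ^ d) * n ^ d
  rows = +-mono-≤ (m^n>0 n {{>-nonZero 1≤n}} d) (≤-trans (rows≤ red dim) (^-doubles d 1≤n))
  exponent : suc d + d ≡ 2 * d + 1
  exponent = trans (sym (+-comm (d + d) 1)) (cong (λ q → d + q + 1) (sym (+-identityʳ d)))

theorem7p3 : (d : ℕ) →
    (∃[ P ] ∃[ c ] ∀ (m n : ℕ) (M : Matrix m n) →
    Reduced M → DefinesComplex M → HasDim M d →
    ∃[ t ] ∃[ s ] ∃[ fs ]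
    (t ≤ c * n ^ (2 * d + 1)) × (run P t (initState M) ≡ just s) ×
    (output (State.mem s) ≡ encodeFaces fs) × IsFaceList M fs)
    ×
    (∃[ P ] ∃[ c ] ∀ (m n : ℕ) (M : Matrix m n) →
    Reduced M → DefinesComplex M → HasDim M d →
    ∃[ t ] ∃[ s ] ∃[ ps ]
    (t ≤ c * n ^ (2 * d + 2)) × (run P t (initState M) ≡ just s) ×
    (output (State.mem s) ≡ encodeMarked ps) × IsMarkedFaceList M ps)
theorem7p3 d =
  (compile FaceMain.main 0 , FaceMain.factor * suc (2 ^ d) , list) ,
  (compile MarkedMain.main 0 , MarkedMain.factor * suc (2 ^ d) , mark)
  where
  open Emitters d using (emitFace; emitFace-cost; emitMarked; emitMarked-cost)
  module FaceMain = Main d emitFace emitFace-cost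
  module MarkedMain = Main d emitMarked emitMarked-cost
  list : ∀ (m n : ℕ) (M : Matrix m n) → Reduced M → DefinesComplex M → HasDim M d →
         ∃[ t ] ∃[ s ] ∃[ fs ]
         (t ≤ FaceMain.factor * suc (2 ^ d) * n ^ (2 * d + 1)) × (run (compile FaceMain.main 0) t (initState M) ≡ just s) ×
         (output (State.mem s) ≡ encodeFaces fs) × IsFaceList M fs
  list m n M red (1≤n , _) dim = conclude
    (FaceMain.run-main M 1≤n (suc m * 1) (≤-reflexive (sym (*-identityʳ (suc m)))) faceWords S.wp-emitFace S.faceWords-length)
    where
    open Independence M
    open FaceLists M
    module S = Emitters.Spec d M (Frame.Spec.β d M) (Frame.Spec.β≥ d M) 1≤n
    conclude : ∃[ t ] ∃[ s ] (t ≤ FaceMain.factor * (n ^ suc d * (suc m * 1)) ×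
                 run (compile FaceMain.main 0) t (initState M) ≡ just s ×
                 output (State.mem s) ≡ Enumeration.words faceWords (suc d) ≤-refl []) →
               ∃[ t ] ∃[ s ] ∃[ fs ]
               (t ≤ FaceMain.factor * suc (2 ^ d) * n ^ (2 * d + 1)) × (run (compile FaceMain.main 0) t (initState M) ≡ just s) ×
               (output (State.mem s) ≡ encodeFaces fs) × IsFaceList M fs
    conclude (t , s , t≤ , eq , out) = t , s , faces (suc d) ,
      ≤-trans t≤ (≤-trans (*-monoʳ-≤ FaceMain.factor (size≤ d 1 M 1≤n red dim)) (≤-reflexive
        (trans (sym (*-assoc FaceMain.factor (suc (2 ^ d)) _)) (cong (FaceMain.factor * suc (2 ^ d) *_) (*-identityʳ _))))) ,
      eq , trans out (encode-faces (Enumeration.enum (suc d) ≤-refl [])) , faces-isFaceList dim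
  mark : ∀ (m n : ℕ) (M : Matrix m n) → Reduced M → DefinesComplex M → HasDim M d →
         ∃[ t ] ∃[ s ] ∃[ ps ]
         (t ≤ MarkedMain.factor * suc (2 ^ d) * n ^ (2 * d + 2)) × (run (compile MarkedMain.main 0) t (initState M) ≡ just s) ×
         (output (State.mem s) ≡ encodeMarked ps) × IsMarkedFaceList M ps
  mark m n M red (1≤n , _) dim = conclude
    (MarkedMain.run-main M 1≤n (suc m * n) (m≤m*n (suc m) n {{>-nonZero 1≤n}}) markedWords S.wp-emitMarked S.markedWords-length)
    where
    open Independence M
    open FaceLists M
    module S = Emitters.Spec d M (Frame.Spec.β d M) (Frame.Spec.β≥ d M) 1≤n
    power : n ^ (2 * d + 1) * n ≡ n ^ (2 * d + 2)
    power = trans (*-comm _ n) (cong (n ^_) (sym (+-suc (2 * d) 1)))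
    conclude : ∃[ t ] ∃[ s ] (t ≤ MarkedMain.factor * (n ^ suc d * (suc m * n)) ×
                 run (compile MarkedMain.main 0) t (initState M) ≡ just s ×
                 output (State.mem s) ≡ Enumeration.words markedWords (suc d) ≤-refl []) →
               ∃[ t ] ∃[ s ] ∃[ ps ]
               (t ≤ MarkedMain.factor * suc (2 ^ d) * n ^ (2 * d + 2)) × (run (compile MarkedMain.main 0) t (initState M) ≡ just s) ×
               (output (State.mem s) ≡ encodeMarked ps) × IsMarkedFaceList M ps
    conclude (t , s , t≤ , eq , out) = t , s , marked (suc d) ,
      ≤-trans t≤ (≤-trans (*-monoʳ-≤ MarkedMain.factor (size≤ d n M 1≤n red dim)) (≤-reflexive
        (trans (sym (*-assoc MarkedMain.factor (suc (2 ^ d)) _)) (cong (MarkedMain.factor * suc (2 ^ d) *_) power)))) ,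
      eq , trans out (encode-marked (Enumeration.enum (suc d) ≤-refl [])) , marked-isMarkedFaceList dim
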